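{- Let $k\ge 2$ be a natural number. There is an algorithm which, given a $k$-automatic set $S$ of natural numbers, decides whether $S$ is an asymptotic additive basis (respectively, an additive basis) for $\mathbb{N}$ and finds the smallest number $j$, if it exists, such that $S$ is an asymptotic additive basis (respectively, an additive basis) of order $j$ for $\mathbb{N}$.
   Context: $\mathbb{N}$ denotes the set of natural numbers (including $0$). The canonical base-$k$ expansion of $n\in\mathbb{N}$ is the unique word over $\{0,1,\ldots,k-1\}$ representing $n$ in base $k$ without leading zeros. A set $S\subseteq\mathbb{N}$ is $k$-automatic if the language of canonical base-$k$ expansions of its elements is regular, i.e., accepted by a deterministic finite automaton (DFA); expansions are read by automata starting with the least significant digit. The set $S$ is given to the algorithm by such an automaton. $S$ is an additive basis (respectively, an asymptotic additive basis) of order $j$ for $\mathbb{N}$ if every natural number (respectively, every sufficiently large natural number) can be written as a sum of at most $j$ members of $S$. $S$ is an additive basis (respectively, an asymptotic additive basis) if it is one of order $j$ for some constant $j$. -}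

module Defs where

open import Data.Digit using (fromDigits)
open import Data.Fin using (Fin; toℕ)
open import Data.Fin.Subset using (Subset) renaming (_∈_ to _∈ₛ_)
open import Data.List using (List; foldl; last; length; sum)
open import Data.List.Relation.Unary.All using (All)
import Data.Maybe.Relation.Unary.All as Maybe
open import Data.Nat using (ℕ; _≤_)
open import Data.Product using (_×_; ∃; ∃-syntax)
open import Function.Bundles using (_⇔_)
open import Level using (0ℓ)
open import Relation.Binary.PropositionalEquality using (_≡_; _≢_)
open import Relation.Unary using (Pred; _∈_)

record DFA (k : ℕ) : Set where
  field
    size      : ℕ
    start     : Fin size
    step      : Fin size → Fin k → Fin size
    accepting : Subset size

Accepts : ∀ {k} → DFA k → List (Fin k) → Set
Accepts M w = foldl step start w ∈ₛ accepting
  where open DFA M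

-- Words are written least significant digit first, as in `fromDigits`, so
-- the leading digit is the last letter.  The expansion of 0 is the empty word.
NoLeadingZeros : ∀ {k} → List (Fin k) → Set
NoLeadingZeros w = Maybe.All (λ d → toℕ d ≢ 0) (last w)

_IsCanonicalExpansionOf_ : ∀ {k} → List (Fin k) → ℕ → Set
w IsCanonicalExpansionOf n = fromDigits w ≡ n × NoLeadingZeros w

-- A set is k-automatic when some DFA over the digits Fin k recognises it.
_Recognises_ : ∀ {k} → DFA k → Pred ℕ 0ℓ → Set
M Recognises S =
  ∀ w → Accepts M w ⇔ (∃[ n ] n ∈ S × w IsCanonicalExpansionOf n)

-- Summands may repeat, and 0 is the empty sum.
SumOfAtMost : ℕ → Pred ℕ 0ℓ → Pred ℕ 0ℓ
SumOfAtMost j S n =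
  ∃[ xs ] length xs ≤ j × All S xs × sum xs ≡ n

IsAdditiveBasisOfOrder : Pred ℕ 0ℓ → Pred ℕ 0ℓ
IsAdditiveBasisOfOrder S j = ∀ n → SumOfAtMost j S n

IsAsymptoticAdditiveBasisOfOrder : Pred ℕ 0ℓ → Pred ℕ 0ℓ
IsAsymptoticAdditiveBasisOfOrder S j =
  ∃[ N ] ∀ n → N ≤ n → SumOfAtMost j S n

IsAdditiveBasis : Pred ℕ 0ℓ → Set
IsAdditiveBasis S = ∃ (IsAdditiveBasisOfOrder S)

IsAsymptoticAdditiveBasis : Pred ℕ 0ℓ → Set
IsAsymptoticAdditiveBasis S = ∃ (IsAsymptoticAdditiveBasisOfOrder S)

IsLeast : Pred ℕ 0ℓ → Pred ℕ 0ℓ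
IsLeast P j = P j × (∀ i → P i → j ≤ i)

{-# OPTIONS --safe #-}
module Submission where

-- A DFA that has a live state with two distinct returning letters has two
-- distinct loops of equal length ℓ at that state, so S contains an affine image
-- of a Cantor-like set in base K = k^ℓ.  Sums of K − 1 members of that set fill
-- arithmetic progressions of length K^m with start O(K^m), whence every large
-- multiple of some d > 0 is a sum of boundedly many members of S; and if S is an
-- asymptotic basis at all, a sum ≡ 1 (mod d) needs at most d summands.  Without
-- such a state the number of members of S below k^m is polynomial in m, and S is
-- not an asymptotic basis.  So the order is bounded in terms of the automaton,
-- and below the bound each order is tested on the automaton of the j-fold sums.

open import Data.Bool using (if_then_else_)
open import Data.Digit using (fromDigits)
open import Data.Fin as Fin using (Fin; zero; suc; toℕ)
open import Data.Fin.Properties as Fin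
  using (any?; pigeonhole; toℕ<n; toℕ-fromℕ<; toℕ-injective; *↔×; 2↔Bool; finToFun-funToFin)
open import Data.Fin.Subset using (Subset; ⁅_⁆; ∣_∣) renaming (_∈_ to _∈ₛ_; _∉_ to _∉ₛ_)
open import Data.Fin.Subset.Properties
  using (_∈?_; x∈⁅x⁆; x∈⁅y⁆⇒x≡y; p⊆q⇒∣p∣≤∣q∣; p⊂q⇒∣p∣<∣q∣; ∣p∣≤n; ∣⁅x⁆∣≡1)
open import Data.List
  using (List; []; _∷_; _++_; map; concat; tabulate; length; take; drop; lookup; foldl; allFin; cartesianProductWith)
open import Data.List.Membership.Propositional using (_∈_)
open import Data.List.Membership.Propositional.Properties
  using (∈-allFin; ∈-map⁺; ∈-map⁻; ∈-concat⁺′; ∈-concat⁻′; ∈-tabulate⁺; ∈-tabulate⁻; ∈-cartesianProductWith⁺)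
open import Data.List.Properties
  using (foldl-++; length-++; length-map; length-take; length-drop; take++drop≡id)
open import Data.List.Relation.Unary.All as All using (All; []; _∷_)
import Data.List.Relation.Unary.All.Properties as All
open import Data.List.Relation.Unary.Any using (here; there; index)
open import Data.List.Relation.Unary.Any.Properties using (lookup-index)
open import Data.Maybe using (Maybe; just; nothing; is-just)
import Data.Maybe.Relation.Unary.All as Maybe
open import Data.Nat
open import Data.Nat.DivMod
open import Data.Nat.ListAction using (sum)
open import Data.Nat.ListAction.Properties using (sum-++)
open import Data.Nat.Properties
open import Data.Nat.Tactic.RingSolver using (solve-∀)
open import Data.Product using (_×_; _,_; ∃; ∃₂; Σ-syntax; proj₁; proj₂)
open import Data.Sum as Sum using (_⊎_; inj₁; inj₂)
open import Data.Vec using () renaming (lookup to lookupᵥ; tabulate to tabulateᵥ)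
open import Data.Vec.Properties
  using (lookup∘tabulate; tabulate∘lookup; tabulate-cong; []=⇒lookup; lookup⇒[]=)
open import Function using (_∘_; _⇔_; mk⇔; _↪_; mk↪; Equivalence; RightInverse; Inverse)
open import Function.Construct.Composition using (_⇔-∘_; _↪-∘_)
open import Function.Construct.Identity using (↔-id)
open import Function.Construct.Symmetry using (↔-sym)
open import Function.Properties.Inverse using (↔⇒↪)
open import Level using (0ℓ)
open import Relation.Binary using (Rel; Tri; tri<; tri≈; tri>) renaming (Decidable to Decidable₂)
open import Relation.Binary.Construct.Closure.ReflexiveTransitive using (Star; ε; _◅_; _◅◅_)
open import Relation.Binary.PropositionalEquality
open import Relation.Nullary
open import Relation.Nullary.Decidable using (map′; _×-dec_; _⊎-dec_; dec-true; ¬?; decidable-stable)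
open import Relation.Nullary.Reflects using (Reflects; ofʸ; ofⁿ)
open import Relation.Unary using (Pred; Decidable)
open import Defs

open Equivalence using (to; from)

-- Sums of members of a set

-- The order bound must be computed before it is known whether a basis exists. So each bound is an
-- implication: if any order works, this one does. One test at the bound then settles existence, and
-- a search below it finds the least order. For bases proper, the asymptotic bound is extended by
-- one observation: 1 must itself be a member, and copies of 1 cover the finitely many numbers that
-- the asymptotic statement leaves out. An order is tested by asking whether an automaton accepts
-- all numbers, or all but finitely many. The first is a question about reachable rejecting states,
-- the second about reachable cycles from which a rejecting state can still be reached through a
-- nonzero digit. Automata for sums guess the digits of the summands, padded to the length of the
-- sum. They must therefore ignore leading zeros, and the given automaton is first converted to one
-- that does.

Sums : ℕ → Pred ℕ 0ℓ → Pred ℕ 0ℓ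
Sums zero    P n = n ≡ 0
Sums (suc j) P n = ∃₂ λ x y → P x × Sums j P y × x + y ≡ n

module _ {P : Pred ℕ 0ℓ} where

  Sums-replicate : ∀ {x} j → P x → Sums j P (j * x)
  Sums-replicate zero    Px = refl
  Sums-replicate (suc j) Px = _ , _ , Px , Sums-replicate j Px , refl

  Sums-++ : ∀ i {j m n} → Sums i P m → Sums j P n → Sums (i + j) P (m + n)
  Sums-++ zero refl                      sₙ = sₙ
  Sums-++ (suc i) (x , y , Px , s , refl) sₙ =
    x , _ , Px , Sums-++ i s sₙ , sym (+-assoc x y _)

  Sums-concat : ∀ i {j n} → Sums i (Sums j P) n → Sums (i * j) P n
  Sums-concat zero    s                      = s
  Sums-concat (suc i) (x , y , sₓ , s , refl) = Sums-++ _ sₓ (Sums-concat i s)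

  -- This is where the exact number of summands in `Sums` matters: the constant `α` enters once per
  -- summand.
  Sums-affine : ∀ {Q : Pred ℕ 0ℓ} α β → (∀ {x} → P x → Q (α + β * x)) →
                ∀ j {n} → Sums j P n → Sums j Q (j * α + β * n)
  Sums-affine α β f zero refl = *-zeroʳ β
  Sums-affine α β f (suc j) (x , y , Px , s , refl) =
    _ , _ , f Px , Sums-affine α β f j s , regroup α β x j y
    where
    regroup : ∀ α β x j y → α + β * x + (j * α + β * y) ≡ α + j * α + β * (x + y)
    regroup = solve-∀

  Sums⇒SumOfAtMost : ∀ j {n} → Sums j P n → SumOfAtMost j P n
  Sums⇒SumOfAtMost zero refl = [] , z≤n , [] , refl
  Sums⇒SumOfAtMost (suc j) (x , y , Px , s , refl) with Sums⇒SumOfAtMost j s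
  ... | xs , ≤j , Pxs , refl = x ∷ xs , s≤s ≤j , Px ∷ Pxs , refl

  -- Greedy: each summand absorbs as much of `t` as its range `L` allows and leaves the truncated
  -- difference to the others.
  Sums-progression : ∀ {B d L} → (∀ t → t ≤ L → P (B + d * t)) →
                     ∀ i t → t ≤ i * L → Sums i P (i * B + d * t)
  Sums-progression {d = d} p zero t z≤n = *-zeroʳ d
  Sums-progression {B} {d} {L} p (suc i) t t≤ =
    _ , _ , p (t ⊓ L) (m⊓n≤n t L) , Sums-progression {d = d} p i (t ∸ L) (m≤n+o⇒m∸n≤o t L t≤) ,
    (begin
      B + d * (t ⊓ L) + (i * B + d * (t ∸ L)) ≡⟨ regroup B d (t ⊓ L) i (t ∸ L) ⟩
      B + i * B + d * (t ⊓ L + (t ∸ L))       ≡⟨ cong (λ □ → B + i * B + d * (□ + (t ∸ L))) (⊓-comm t L) ⟩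
      B + i * B + d * (L ⊓ t + (t ∸ L))       ≡⟨ cong (λ □ → B + i * B + d * □) (m⊓n+n∸m≡n L t) ⟩
      B + i * B + d * t                       ∎)
    where
    open ≡-Reasoning
    regroup : ∀ B d s i u → B + d * s + (i * B + d * u) ≡ B + i * B + d * (s + u)
    regroup = solve-∀

SumOfAtMost-mono : ∀ {S i j n} → i ≤ j → SumOfAtMost i S n → SumOfAtMost j S n
SumOfAtMost-mono i≤j (xs , ≤i , rest) = xs , ≤-trans ≤i i≤j , rest

SumOfAtMost-+ : ∀ {S i j m n} → SumOfAtMost i S m → SumOfAtMost j S n →
                SumOfAtMost (i + j) S (m + n)
SumOfAtMost-+ (xs , ≤i , Sxs , refl) (ys , ≤j , Sys , refl) =
  xs ++ ys , ≤-trans (≤-reflexive (length-++ xs)) (+-mono-≤ ≤i ≤j) ,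
  All.++⁺ Sxs Sys , sum-++ xs ys

SumOfAtMost-* : ∀ {S j n} r → SumOfAtMost j S n → SumOfAtMost (r * j) S (r * n)
SumOfAtMost-* zero    s = [] , z≤n , [] , refl
SumOfAtMost-* (suc r) s = SumOfAtMost-+ s (SumOfAtMost-* r s)

-- The ranges [iB, i(B + L)] for consecutive i ≥ C overlap because B ≤ CL.
overlapping-ranges : ∀ {B L C} → B ≤ C * L → ∀ i n → C * B ≤ n → n ≤ (C + i) * (B + L) →
                     ∃ λ j → j ≤ C + i × j * B ≤ n × n ≤ j * (B + L)
overlapping-ranges {B} {L} {C} B≤CL zero n CB≤n n≤ =
  C , m≤m+n C 0 , CB≤n , subst (λ □ → n ≤ □ * (B + L)) (+-identityʳ C) n≤
overlapping-ranges {B} {L} {C} B≤CL (suc i) n CB≤n n≤ with ≤-total n ((C + i) * (B + L))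
... | inj₁ n≤′ with overlapping-ranges B≤CL i n CB≤n n≤′
...   | j , j≤ , lower , upper = j , ≤-trans j≤ (+-monoʳ-≤ C (n≤1+n i)) , lower , upper
overlapping-ranges {B} {L} {C} B≤CL (suc i) n CB≤n n≤ | inj₂ ≤n =
  C + suc i , ≤-refl , lower , n≤
  where
  open ≤-Reasoning
  lower : (C + suc i) * B ≤ n
  lower = begin
    (C + suc i) * B             ≡⟨ cong (_* B) (+-suc C i) ⟩
    B + (C + i) * B             ≤⟨ +-monoˡ-≤ _ (≤-trans B≤CL (*-monoˡ-≤ L (m≤m+n C i))) ⟩
    (C + i) * L + (C + i) * B   ≡⟨ *-distribˡ-+ (C + i) L B ⟨
    (C + i) * (L + B)           ≡⟨ cong ((C + i) *_) (+-comm L B) ⟩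
    (C + i) * (B + L)           ≤⟨ ≤n ⟩
    n                           ∎

n<b^n : ∀ b n → 2 ≤ b → n < b ^ n
n<b^n b zero    2≤b = s≤s z≤n
n<b^n b (suc n) 2≤b = begin-strict
  suc n             ≤⟨ n<b^n b n 2≤b ⟩
  b ^ n             <⟨ m<m*n (b ^ n) b {{m^n≢0 b n}} 2≤b ⟩
  b ^ n * b         ≡⟨ *-comm (b ^ n) b ⟩
  b * b ^ n         ∎
  where
  open ≤-Reasoning
  instance
    _ : NonZero b
    _ = >-nonZero (≤-trans (s≤s z≤n) 2≤b)

-- Search downwards from exponent `n`, where `n < K ^ n` gives the upper bound; `D ≤ n` supplies the
-- lower bound if the search gets down to exponent 0.
geometric-bracket : ∀ {K} D n → 2 ≤ K → 1 ≤ D → D ≤ n → ∃ λ m → D * K ^ m ≤ n × n < D * K ^ suc m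
geometric-bracket {K} D n 2≤K 1≤D D≤n = descend n (begin-strict
  n             <⟨ n<b^n K n 2≤K ⟩
  K ^ n         ≤⟨ ^-monoʳ-≤ K (n≤1+n n) ⟩
  K ^ suc n     ≤⟨ m≤n*m (K ^ suc n) D ⟩
  D * K ^ suc n ∎)
  where
  open ≤-Reasoning
  instance
    _ : NonZero K
    _ = >-nonZero (≤-trans (s≤s z≤n) 2≤K)
    _ : NonZero D
    _ = >-nonZero 1≤D
  descend : ∀ m → n < D * K ^ suc m → ∃ λ m → D * K ^ m ≤ n × n < D * K ^ suc m
  descend zero    n< = 0 , subst (_≤ n) (sym (*-identityʳ D)) D≤n , n<
  descend (suc m) n< with D * K ^ suc m ≤? n
  ... | yes ≤n = suc m , ≤n , n<
  ... | no  ≰n = descend m (≰⇒> ≰n)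

-- The bound on B keeps the numbers of summands needed at level m within a fixed range.
progressions⇒multiples :
  ∀ {P : Pred ℕ 0ℓ} d {K} C → 2 ≤ K → 1 ≤ C → 1 ≤ d →
  (∀ m → ∃ λ B → B ≤ C * K ^ m × (∀ t → t ≤ K ^ m → P (B + d * t))) →
  ∀ n → C * C ≤ n → ∃ λ j → j ≤ d * (C + C * C * K) × Sums j P (d * n)
progressions⇒multiples {P} d {K} C 2≤K 1≤C 1≤d progression n CC≤n
  -- The lower end gives `C * B ≤ n` because `B ≤ C * K ^ m`; the upper end keeps `n` below the end
  -- of range number `C + C * C * K`, a number independent of `m`.
  with geometric-bracket (C * C) n 2≤K (*-mono-≤ 1≤C 1≤C) CC≤n
... | m , lower , upper with progression m
... | B , B≤ , p with overlapping-ranges {B} {K ^ m} {C} B≤ (C * C * K) n CB≤n n≤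
  where
  open ≤-Reasoning
  CB≤n : C * B ≤ n
  CB≤n = begin
    C * B           ≤⟨ *-monoʳ-≤ C B≤ ⟩
    C * (C * K ^ m) ≡⟨ *-assoc C C (K ^ m) ⟨
    C * C * K ^ m   ≤⟨ lower ⟩
    n               ∎
  n≤ : n ≤ (C + C * C * K) * (B + K ^ m)
  n≤ = begin
    n                                 ≤⟨ <⇒≤ upper ⟩
    C * C * (K * K ^ m)               ≡⟨ *-assoc (C * C) K (K ^ m) ⟨
    C * C * K * K ^ m                 ≤⟨ *-mono-≤ (m≤n+m (C * C * K) C) (m≤n+m (K ^ m) B) ⟩
    (C + C * C * K) * (B + K ^ m)     ∎
-- With `d * i` members instead of `i`, the starts add up to a multiple of `d`, and what is missing
-- from `d * n` is `n ∸ i * B` steps of length `d`.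
... | i , i≤ , iB≤n , n≤ = d * i , *-monoʳ-≤ d i≤ ,
  subst (Sums (d * i) P) total (Sums-progression {d = d} p (d * i) (n ∸ i * B) t≤)
  where
  t≤ : n ∸ i * B ≤ d * i * K ^ m
  t≤ = begin
    n ∸ i * B     ≤⟨ m≤n+o⇒m∸n≤o n (i * B) (≤-trans n≤ (≤-reflexive (*-distribˡ-+ i B (K ^ m)))) ⟩
    i * K ^ m     ≤⟨ *-monoˡ-≤ (K ^ m) (m≤n*m i d {{>-nonZero 1≤d}}) ⟩
    d * i * K ^ m ∎
    where open ≤-Reasoning
  total : d * i * B + d * (n ∸ i * B) ≡ d * n
  total = begin
    d * i * B + d * (n ∸ i * B)   ≡⟨ cong (_+ d * (n ∸ i * B)) (*-assoc d i B) ⟩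
    d * (i * B) + d * (n ∸ i * B) ≡⟨ *-distribˡ-+ d (i * B) _ ⟨
    d * (i * B + (n ∸ i * B))     ≡⟨ cong (d *_) (m+[n∸m]≡n iB≤n) ⟩
    d * n                         ∎
    where open ≡-Reasoning

-- Two prefix sums agree modulo d; cut out the segment between them.
shorten-once : ∀ {S : Pred ℕ 0ℓ} d .{{_ : NonZero d}} xs → All S xs → d < length xs →
               ∃ λ ys → All S ys × length ys < length xs × ∃ λ z → sum xs ≡ sum ys + z * d
shorten-once d xs Sxs d<∣xs∣ = ys , All.++⁺ (All.take⁺ p Sxs) (All.drop⁺ q Sxs) , shorter , z , total
  where
  prefix : ℕ → ℕ
  prefix i = sum (take i xs)
  collision = pigeonhole (n<1+n d) (λ i → prefix (toℕ i) mod d)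
  p = toℕ (proj₁ collision)
  q = toℕ (proj₁ (proj₂ collision))
  p<q : p < q
  p<q = proj₁ (proj₂ (proj₂ collision))
  same : prefix p mod d ≡ prefix q mod d
  same = proj₂ (proj₂ (proj₂ collision))
  q≤∣xs∣ : q ≤ length xs
  q≤∣xs∣ = ≤-trans (s≤s⁻¹ (toℕ<n (proj₁ (proj₂ collision)))) (<⇒≤ d<∣xs∣)
  ys = take p xs ++ drop q xs
  shorter : length ys < length xs
  shorter = begin-strict
    length ys                                   ≡⟨ length-++ (take p xs) ⟩
    length (take p xs) + length (drop q xs)     ≡⟨ cong₂ _+_ (length-take p xs) (length-drop q xs) ⟩
    p ⊓ length xs + (length xs ∸ q)             ≤⟨ +-monoˡ-≤ _ (m⊓n≤m p (length xs)) ⟩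
    p + (length xs ∸ q)                         <⟨ +-monoˡ-< _ p<q ⟩
    q + (length xs ∸ q)                         ≡⟨ m+[n∸m]≡n q≤∣xs∣ ⟩
    length xs                                   ∎
    where open ≤-Reasoning
  prefix-mono : ∀ {i j} → i ≤ j → ∀ xs → sum (take i xs) ≤ sum (take j xs)
  prefix-mono z≤n       xs       = z≤n
  prefix-mono (s≤s i≤j) []       = z≤n
  prefix-mono (s≤s i≤j) (x ∷ xs) = +-monoʳ-≤ x (prefix-mono i≤j xs)
  z = prefix q / d ∸ prefix p / d
  remainder : prefix p % d ≡ prefix q % d
  remainder = trans (sym (toℕ-mod p)) (trans (cong toℕ same) (toℕ-mod q))
    where
    toℕ-mod : ∀ i → toℕ (prefix i mod d) ≡ prefix i % d
    toℕ-mod i = toℕ-fromℕ< (m%n<n (prefix i) d)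
  quotients : prefix p / d + z ≡ prefix q / d
  quotients = m+[n∸m]≡n (/-monoˡ-≤ d (prefix-mono (<⇒≤ p<q) xs))
  gap : prefix q ≡ prefix p + z * d
  gap = begin
    prefix q                                            ≡⟨ m≡m%n+[m/n]*n (prefix q) d ⟩
    prefix q % d + prefix q / d * d                     ≡⟨ cong₂ (λ □ ■ → □ + ■ * d) remainder quotients ⟨
    prefix p % d + (prefix p / d + z) * d               ≡⟨ regroup (prefix p % d) (prefix p / d) z d ⟩
    prefix p % d + prefix p / d * d + z * d             ≡⟨ cong (_+ z * d) (m≡m%n+[m/n]*n (prefix p) d) ⟨
    prefix p + z * d                                    ∎
    where
    open ≡-Reasoning
    regroup : ∀ r a z d → r + (a + z) * d ≡ r + a * d + z * d
    regroup = solve-∀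
  total : sum xs ≡ sum ys + z * d
  total = begin
    sum xs                                 ≡⟨ cong sum (take++drop≡id q xs) ⟨
    sum (take q xs ++ drop q xs)           ≡⟨ sum-++ (take q xs) (drop q xs) ⟩
    prefix q + sum (drop q xs)             ≡⟨ cong (_+ sum (drop q xs)) gap ⟩
    prefix p + z * d + sum (drop q xs)     ≡⟨ regroup (prefix p) (z * d) _ ⟩
    prefix p + sum (drop q xs) + z * d     ≡⟨ cong (_+ z * d) (sum-++ (take p xs) (drop q xs)) ⟨
    sum ys + z * d                         ∎
    where
    open ≡-Reasoning
    regroup : ∀ a b c → a + b + c ≡ a + c + b
    regroup = solve-∀

-- Once the tail is cut to at most `d` summands, a new head makes at most `d + 1`, so a single
-- further cut suffices.
shorten : ∀ {S : Pred ℕ 0ℓ} d .{{_ : NonZero d}} xs → All S xs →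
          ∃ λ ys → All S ys × length ys ≤ d × ∃ λ z → sum xs ≡ sum ys + z * d
shorten d []       []         = [] , [] , z≤n , 0 , refl
shorten d (x ∷ xs) (Sx ∷ Sxs) with shorten d xs Sxs
... | ys , Sys , ∣ys∣≤d , z , eq with length ys <? d
...   | yes ∣ys∣<d = x ∷ ys , Sx ∷ Sys , ∣ys∣<d , z , trans (cong (x +_) eq) (sym (+-assoc x _ _))
...   | no  ∣ys∣≮d with shorten-once d (x ∷ ys) (Sx ∷ Sys) (s≤s (≮⇒≥ ∣ys∣≮d))
...     | zs , Szs , shorter , z′ , eq′ =
  zs , Szs , s≤s⁻¹ (≤-trans shorter (s≤s ∣ys∣≤d)) , z′ + z , (begin
    x + sum xs                 ≡⟨ cong (x +_) eq ⟩
    x + (sum ys + z * d)       ≡⟨ +-assoc x _ _ ⟨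
    x + sum ys + z * d         ≡⟨ cong (_+ z * d) eq′ ⟩
    sum zs + z′ * d + z * d    ≡⟨ regroup (sum zs) z′ z d ⟩
    sum zs + (z′ + z) * d      ∎)
  where
  open ≡-Reasoning
  regroup : ∀ s a z d → s + a * d + z * d ≡ s + (a + z) * d
  regroup = solve-∀

-- A sum ≡ 1 (mod d) may be taken with at most d summands; repeating it
-- n % d times leaves a multiple of d.
multiples⇒order : ∀ {S} d .{{_ : NonZero d}} J N₀ → (∀ n → N₀ ≤ n → SumOfAtMost J S (d * n)) →
                  IsAsymptoticAdditiveBasis S → IsAsymptoticAdditiveBasisOfOrder S (d * d + J)
-- The sample `1 + N₁ * d` is congruent to 1 and at least `N₁`, so the basis property applies to it.
multiples⇒order {S} d J N₀ multiples (j , N₁ , basis) with basis (1 + N₁ * d) (≤-trans (m≤m*n N₁ d) (n≤1+n _))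
... | xs , _ , Sxs , eqₓ with shorten d xs Sxs
-- In units of `d`: `d * N₁` makes room for fewer than `d` copies of the sample, and `N₀` for the
-- multiple of `d` that is left over.
... | ys , Sys , ∣ys∣≤d , z , eq = (d * N₁ + N₀) * d , enough
  where
  s≡1 : sum ys + z * d ≡ 1 + N₁ * d
  s≡1 = trans (sym eq) eqₓ
  enough : ∀ n → (d * N₁ + N₀) * d ≤ n → SumOfAtMost (d * d + J) S n
  enough n N≤n = subst (SumOfAtMost (d * d + J) S) total
    (SumOfAtMost-+ (SumOfAtMost-mono (*-mono-≤ (<⇒≤ (m%n<n n d)) ∣ys∣≤d) (SumOfAtMost-* r (ys , ≤-refl , Sys , refl)))
                   -- Each of the `r` copies lost `z * d` when it was shortened; the multiple of `d`
                   -- makes up for it.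
                   (multiples (e + r * z) (≤-trans N₀≤e (m≤m+n e _))))
    where
    r = n % d
    quotient-large : d * N₁ + N₀ ≤ n / d
    quotient-large = subst (_≤ n / d) (m*n/n≡m (d * N₁ + N₀) d) (/-monoˡ-≤ d N≤n)
    rN₁+N₀≤ : r * N₁ + N₀ ≤ n / d
    rN₁+N₀≤ = ≤-trans (+-monoˡ-≤ N₀ (*-monoˡ-≤ N₁ (<⇒≤ (m%n<n n d)))) quotient-large
    e = n / d ∸ r * N₁
    N₀≤e : N₀ ≤ e
    N₀≤e = m+n≤o⇒m≤o∸n N₀ (≤-trans (≤-reflexive (+-comm N₀ _)) rN₁+N₀≤)
    regroup₁ : ∀ r s d e z → r * s + d * (e + r * z) ≡ r * (s + z * d) + e * d
    regroup₁ = solve-∀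
    regroup₂ : ∀ r N d e → r * (1 + N * d) + e * d ≡ r + (r * N + e) * d
    regroup₂ = solve-∀
    total : r * sum ys + d * (e + r * z) ≡ n
    total = begin
      r * sum ys + d * (e + r * z)         ≡⟨ regroup₁ r (sum ys) d e z ⟩
      r * (sum ys + z * d) + e * d         ≡⟨ cong (λ □ → r * □ + e * d) s≡1 ⟩
      r * (1 + N₁ * d) + e * d             ≡⟨ regroup₂ r N₁ d e ⟩
      r + (r * N₁ + e) * d                 ≡⟨ cong (λ □ → r + □ * d) (m+[n∸m]≡n (≤-trans (m≤m+n _ N₀) rN₁+N₀≤)) ⟩
      r + n / d * d                        ≡⟨ m≡m%n+[m/n]*n n d ⟨
      n                                    ∎
      where open ≡-Reasoning

-- Counting sums against exponential growth

linear≤exponential : ∀ a b → ∃ λ s → a + s * b ≤ 2 ^ s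
-- With `t = a + 2b` the right side is the square of `2 ^ t ≥ t + 1`, while the left side is at most
-- `t + t * t`.
linear≤exponential a b = t + t , (begin
  a + (t + t) * b         ≡⟨ regroup₁ a t b ⟩
  a + t * (b + b)         ≤⟨ +-mono-≤ (m≤m+n a (b + b)) (*-monoʳ-≤ t (m≤n+m (b + b) a)) ⟩
  t + t * t               ≡⟨⟩
  suc t * t               ≤⟨ *-monoʳ-≤ (suc t) (n≤1+n t) ⟩
  suc t * suc t           ≤⟨ *-mono-≤ (n<b^n 2 t ≤-refl) (n<b^n 2 t ≤-refl) ⟩
  2 ^ t * 2 ^ t           ≡⟨ ^-distribˡ-+-* 2 t t ⟨
  2 ^ (t + t)             ∎)
  where
  open ≤-Reasoning
  t = a + (b + b)
  regroup₁ : ∀ a t b → a + (t + t) * b ≡ a + t * (b + b)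
  regroup₁ = solve-∀

2^m+2^n≤2^[1+m+n] : ∀ m n → 2 ^ m + 2 ^ n ≤ 2 ^ suc (m + n)
2^m+2^n≤2^[1+m+n] m n = begin
  2 ^ m + 2 ^ n             ≤⟨ +-mono-≤ (^-monoʳ-≤ 2 (m≤m+n m n)) (^-monoʳ-≤ 2 (m≤n+m n m)) ⟩
  2 ^ (m + n) + 2 ^ (m + n) ≡⟨ cong (2 ^ (m + n) +_) (+-identityʳ _) ⟨
  2 ^ suc (m + n)           ∎
  where open ≤-Reasoning

-- Take `m + 1 = 2 ^ s`. The polynomial in `m + 1` is then at most a power of 2 whose exponent is
-- linear in `s`, whereas `k ^ m` is at least 2 to the power `2 ^ s - 1`.
polynomial<exponential : ∀ {k} → 2 ≤ k → ∀ r j N → ∃ λ m → N + suc ((suc ((k * suc m) ^ r)) ^ j) ≤ k ^ m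
polynomial<exponential {k} 2≤k r j N
  with linear≤exponential (3 + N + (k * r + 1) * j) (r * j)
... | s , large = m , (begin
  N + suc (suc ((k * suc m) ^ r) ^ j) ≡⟨ +-suc N _ ⟩
  suc N + suc ((k * suc m) ^ r) ^ j   ≤⟨ +-mono-≤ (n<b^n 2 N ≤-refl) power ⟩
  2 ^ N + 2 ^ (f * j)                 ≤⟨ 2^m+2^n≤2^[1+m+n] N (f * j) ⟩
  2 ^ suc (N + f * j)                 ≤⟨ ^-monoʳ-≤ 2 exponent ⟩
  2 ^ m                               ≤⟨ ^-monoˡ-≤ m 2≤k ⟩
  k ^ m                               ∎)
  where
  open ≤-Reasoning
  m = pred (2 ^ s)
  1+m≡2^s : suc m ≡ 2 ^ s
  1+m≡2^s = suc-pred (2 ^ s) {{m^n≢0 2 s}}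
  f = suc ((k + s) * r + 0)
  base : k * suc m ≤ 2 ^ (k + s)
  base = begin
    k * suc m       ≡⟨ cong (k *_) 1+m≡2^s ⟩
    k * 2 ^ s       ≤⟨ *-monoˡ-≤ (2 ^ s) (<⇒≤ (n<b^n 2 k ≤-refl)) ⟩
    2 ^ k * 2 ^ s   ≡⟨ ^-distribˡ-+-* 2 k s ⟨
    2 ^ (k + s)     ∎
  power : suc ((k * suc m) ^ r) ^ j ≤ 2 ^ (f * j)
  power = begin
    suc ((k * suc m) ^ r) ^ j          ≤⟨ ^-monoˡ-≤ j (s≤s (^-monoˡ-≤ r base)) ⟩
    suc ((2 ^ (k + s)) ^ r) ^ j        ≡⟨ cong (λ □ → suc □ ^ j) (^-*-assoc 2 (k + s) r) ⟩
    suc (2 ^ ((k + s) * r)) ^ j        ≡⟨ cong (_^ j) (+-comm 1 _) ⟩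
    (2 ^ ((k + s) * r) + 2 ^ 0) ^ j    ≤⟨ ^-monoˡ-≤ j (2^m+2^n≤2^[1+m+n] ((k + s) * r) 0) ⟩
    (2 ^ f) ^ j                        ≡⟨ ^-*-assoc 2 f j ⟩
    2 ^ (f * j)                        ∎
  exponent : suc (N + f * j) ≤ m
  exponent = s≤s⁻¹ (begin
    suc (suc (N + f * j))                         ≤⟨ n≤1+n _ ⟩
    suc (suc (suc (N + f * j)))                   ≡⟨ regroup N k s r j ⟩
    3 + N + (k * r + 1) * j + s * (r * j)         ≤⟨ large ⟩
    2 ^ s                                         ≡⟨ 1+m≡2^s ⟨
    suc m                                         ∎)
    where
    regroup : ∀ N k s r j → suc (suc (suc (N + suc ((k + s) * r + 0) * j))) ≡ 3 + N + (k * r + 1) * j + s * (r * j)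
    regroup = solve-∀

-- Adjoining 0 to `V` turns "at most `j` summands" into "exactly `j`", which makes the number of
-- entries a plain power.
sumsOf : ℕ → List ℕ → List ℕ
sumsOf zero    V = 0 ∷ []
sumsOf (suc j) V = cartesianProductWith _+_ (0 ∷ V) (sumsOf j V)

length-cartesianProductWith : ∀ {A B C : Set} (f : A → B → C) xs ys →
                              length (cartesianProductWith f xs ys) ≡ length xs * length ys
length-cartesianProductWith f []       ys = refl
length-cartesianProductWith f (x ∷ xs) ys =
  trans (length-++ (map (f x) ys)) (cong₂ _+_ (length-map (f x) ys) (length-cartesianProductWith f xs ys))

length-sumsOf : ∀ j V → length (sumsOf j V) ≡ suc (length V) ^ j
length-sumsOf zero    V = refl
length-sumsOf (suc j) V =
  trans (length-cartesianProductWith _+_ (0 ∷ V) (sumsOf j V)) (cong (suc (length V) *_) (length-sumsOf j V))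

∈-sumsOf : ∀ j {V} xs → length xs ≤ j → All (_∈ V) xs → sum xs ∈ sumsOf j V
∈-sumsOf zero    []       z≤n        []         = here refl
∈-sumsOf (suc j) {V} []       z≤n        []         =
  ∈-cartesianProductWith⁺ _+_ {xs = 0 ∷ V} (here refl) (∈-sumsOf j [] z≤n [])
∈-sumsOf (suc j) (x ∷ xs) (s≤s ∣xs∣≤j) (x∈V ∷ xs∈V) =
  ∈-cartesianProductWith⁺ _+_ (there x∈V) (∈-sumsOf j xs ∣xs∣≤j xs∈V)

¬covers-longer-interval : ∀ N (xs : List ℕ) → ¬ (∀ n → N ≤ n → n < N + suc (length xs) → n ∈ xs)
¬covers-longer-interval N xs covers = <⇒≢ i<j (+-cancelˡ-≡ N _ _ same)
  where
  member : ∀ (i : Fin (suc (length xs))) → N + toℕ i ∈ xs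
  member i = covers (N + toℕ i) (m≤m+n N _) (+-monoʳ-< N (toℕ<n i))
  collision = pigeonhole (n<1+n (length xs)) (λ i → index (member i))
  i = proj₁ collision
  j = proj₁ (proj₂ collision)
  i<j : toℕ i < toℕ j
  i<j = proj₁ (proj₂ (proj₂ collision))
  same : N + toℕ i ≡ N + toℕ j
  same = begin
    N + toℕ i                    ≡⟨ lookup-index (member i) ⟩
    lookup xs (index (member i)) ≡⟨ cong (lookup xs) (proj₂ (proj₂ (proj₂ collision))) ⟩
    lookup xs (index (member j)) ≡⟨ lookup-index (member j) ⟨
    N + toℕ j                    ∎
    where open ≡-Reasoning

IsLeast-exists : ∀ {P : Pred ℕ 0ℓ} → Decidable P → ∀ j → P j → ∃ (IsLeast P)
IsLeast-exists P? zero    P0 = 0 , P0 , λ _ _ → z≤n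
IsLeast-exists {P} P? (suc j) Pj with P? 0
... | yes P0 = 0 , P0 , λ _ _ → z≤n
... | no ¬P0 with IsLeast-exists (P? ∘ suc) j Pj
...   | l , Pl , l≤ = suc l , Pl , least
  where
  least : ∀ i → P i → suc l ≤ i
  least zero    P0 = contradiction P0 ¬P0
  least (suc i) Pi = s≤s (l≤ i Pi)

-- Base-k words

digit-unique : ∀ {k r s} x y → r < k → s < k → r + x * k ≡ s + y * k → r ≡ s × x ≡ y
digit-unique {k} {r} {s} x y r<k s<k eq = r≡s ,
  *-cancelʳ-≡ x y k (+-cancelˡ-≡ r (x * k) (y * k) (trans eq (cong (_+ y * k) (sym r≡s))))
  where
  instance
    _ : NonZero k
    _ = >-nonZero (≤-trans (s≤s z≤n) r<k)
  open ≡-Reasoning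
  r≡s : r ≡ s
  r≡s = begin
    r               ≡⟨ m<n⇒m%n≡m r<k ⟨
    r % k           ≡⟨ [m+kn]%n≡m%n r x k ⟨
    (r + x * k) % k ≡⟨ cong (_% k) eq ⟩
    (s + y * k) % k ≡⟨ [m+kn]%n≡m%n s y k ⟩
    s % k           ≡⟨ m<n⇒m%n≡m s<k ⟩
    s               ∎

fromDigits-++ : ∀ {k} (u w : List (Fin k)) →
                fromDigits (u ++ w) ≡ fromDigits u + fromDigits w * k ^ length u
fromDigits-++     []      w = sym (*-identityʳ _)
fromDigits-++ {k} (a ∷ u) w = trans (cong (λ □ → toℕ a + □ * k) (fromDigits-++ u w))
                                    (regroup (toℕ a) (fromDigits u) (fromDigits w) (k ^ length u) k)
  where
  regroup : ∀ a U W p k → a + (U + W * p) * k ≡ a + U * k + W * (k * p)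
  regroup = solve-∀

fromDigits<k^length : ∀ {k} (w : List (Fin k)) → fromDigits w < k ^ length w
fromDigits<k^length     []      = s≤s z≤n
fromDigits<k^length {k} (a ∷ w) = begin-strict
  toℕ a + fromDigits w * k <⟨ +-monoˡ-< _ (toℕ<n a) ⟩
  suc (fromDigits w) * k   ≤⟨ *-monoˡ-≤ k (fromDigits<k^length w) ⟩
  k ^ length w * k         ≡⟨ *-comm _ k ⟩
  k ^ length (a ∷ w)       ∎
  where open ≤-Reasoning

low-digits : ∀ k .{{_ : NonZero k}} s n →
             Σ[ u ∈ List (Fin k) ] length u ≡ s × ∃ λ n′ → fromDigits u + n′ * k ^ s ≡ n
low-digits k zero    n = [] , refl , n , *-identityʳ n
low-digits k (suc s) n with low-digits k s (n / k)
... | u , refl , n′ , eq = n mod k ∷ u , refl , n′ , (begin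
  toℕ (n mod k) + fromDigits u * k + n′ * (k * k ^ length u)
    ≡⟨ regroup (toℕ (n mod k)) (fromDigits u) k n′ (k ^ length u) ⟩
  toℕ (n mod k) + (fromDigits u + n′ * k ^ length u) * k
    ≡⟨ cong₂ (λ □ ■ → □ + ■ * k) (toℕ-fromℕ< (m%n<n n k)) eq ⟩
  n % k + n / k * k
    ≡⟨ m≡m%n+[m/n]*n n k ⟨
  n ∎)
  where
  open ≡-Reasoning
  regroup : ∀ a U k n p → a + U * k + n * (k * p) ≡ a + (U + n * p) * k
  regroup = solve-∀

digits-of-length : ∀ k .{{_ : NonZero k}} s {n} → n < k ^ s →
                   Σ[ u ∈ List (Fin k) ] length u ≡ s × fromDigits u ≡ n
digits-of-length k s {n} n< with low-digits k s n
... | u , len , zero   , eq = u , len , trans (sym (+-identityʳ _)) eq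
... | u , len , suc n′ , eq =
  contradiction n< (≤⇒≯ (≤-trans (≤-trans (m≤m+n _ _) (m≤n+m _ (fromDigits u))) (≤-reflexive eq)))

-- Finite-state recognisers

⟦_⟧ : ∀ {n} {P : Pred (Fin n) 0ℓ} → Decidable P → Subset n
⟦ P? ⟧ = tabulateᵥ (λ i → does (P? i))

module _ {n} {P : Pred (Fin n) 0ℓ} (P? : Decidable P) where

  ∈⟦⟧⁺ : ∀ {i} → P i → i ∈ₛ ⟦ P? ⟧
  ∈⟦⟧⁺ {i} p = lookup⇒[]= i _ (trans (lookup∘tabulate _ i) (dec-true (P? i) p))

  ∈⟦⟧⁻ : ∀ {i} → i ∈ₛ ⟦ P? ⟧ → P i
  ∈⟦⟧⁻ {i} i∈ with P? i | trans (sym (lookup∘tabulate (λ i → does (P? i)) i)) ([]=⇒lookup i∈)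
  ... | yes p | _ = p

-- Leading zeros of the word must not matter here, unlike in _Recognises_.
record Recogniser (k : ℕ) (P : Pred ℕ 0ℓ) : Set where
  field
    dfa     : DFA k
    correct : ∀ w → Accepts dfa w ⇔ P (fromDigits w)

Recogniser-⇔ : ∀ {k P Q} → (∀ n → P n ⇔ Q n) → Recogniser k P → Recogniser k Q
Recogniser-⇔ P⇔Q R = record { dfa = dfa ; correct = λ w → P⇔Q _ ⇔-∘ correct w }
  where open Recogniser R

-- A run on codes never leaves the image of `encode`, where decoding undoes encoding; so a
-- retraction of `Fin n` onto the states suffices.
finite-state : ∀ {k P n} {A : Set} → A ↪ Fin n → (start : A) (step : A → Fin k → A) →
               {Final : Pred A 0ℓ} → Decidable Final →
               (∀ w → Final (foldl step start w) ⇔ P (fromDigits w)) → Recogniser k P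
finite-state {k} {n = n} {A} A↪Fin start step {Final} Final? correct = record
  { dfa = record { size = n ; start = encode start ; step = stepₙ ; accepting = ⟦ finalₙ? ⟧ }
  ; correct = λ w → mk⇔
      (λ acc → to (correct w) (subst Final (run start w) (∈⟦⟧⁻ finalₙ? acc)))
      (λ p → ∈⟦⟧⁺ finalₙ? (subst Final (sym (run start w)) (from (correct w) p))) }
  where
  open RightInverse A↪Fin using () renaming (to to encode; from to decode; strictlyInverseʳ to decode-encode)
  finalₙ? : Decidable (Final ∘ decode)
  finalₙ? i = Final? (decode i)
  stepₙ : Fin n → Fin k → Fin n
  stepₙ i a = encode (step (decode i) a)
  run : ∀ s w → decode (foldl stepₙ (encode s) w) ≡ foldl step s w
  run s []      = decode-encode s
  run s (a ∷ w) = trans (cong (λ □ → decode (foldl stepₙ (encode (step □ a)) w)) (decode-encode s)) (run (step s a) w)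

×↪Fin : ∀ {A : Set} {m n} → A ↪ Fin n → (Fin m × A) ↪ Fin (m * n)
×↪Fin {A} {m} {n} A↪ = ↔⇒↪ (↔-sym *↔×) ↪-∘ mk↪ {to = λ (i , a) → i , encode a} {from = λ (i , j) → i , decode j}
  λ { refl → cong (_ ,_) (decode-encode _) }
  where
  open RightInverse A↪ using () renaming (to to encode; from to decode; strictlyInverseʳ to decode-encode)

Subset↪Fin : ∀ n → Subset n ↪ Fin (2 ^ n)
Subset↪Fin n = mk↪ {to = λ X → Fin.funToFin (Inverse.from 2↔Bool ∘ lookupᵥ X)}
                   {from = λ i → tabulateᵥ (Inverse.to 2↔Bool ∘ Fin.finToFun i)}
  λ { {X} refl → trans
      (tabulate-cong (λ i → trans (cong (Inverse.to 2↔Bool) (finToFun-funToFin (Inverse.from 2↔Bool ∘ lookupᵥ X) i))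
                                  (Inverse.strictlyInverseˡ 2↔Bool (lookupᵥ X i))))
      (tabulate∘lookup X) }

-- The subset construction. Correctness is demanded for `AcceptsFrom`, so that its users reason
-- about nondeterministic runs and never about sets of states.
module Nondeterministic {k N} {A : Set} (A↪Fin : A ↪ Fin N) (start : A)
  {Edge : A → Fin k → A → Set} (edge? : ∀ s a t → Dec (Edge s a t))
  {Final : Pred A 0ℓ} (final? : Decidable Final) where

  open RightInverse A↪Fin using () renaming (to to encode; from to decode; strictlyInverseʳ to decode-encode)

  AcceptsFrom : A → List (Fin k) → Set
  AcceptsFrom s []      = Final s
  AcceptsFrom s (a ∷ w) = ∃ λ t → Edge s a t × AcceptsFrom t w

  private
    successor? : ∀ X a j → Dec (∃ λ i → i ∈ₛ X × Edge (decode i) a (decode j))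
    successor? X a j = any? λ i → (i ∈? X) ×-dec edge? (decode i) a (decode j)

    stepₛ : Subset N → Fin k → Subset N
    stepₛ X a = ⟦ successor? X a ⟧

    Finalₛ : Pred (Subset N) 0ℓ
    Finalₛ X = ∃ λ i → i ∈ₛ X × Final (decode i)

    subset-run : ∀ w X → Finalₛ (foldl stepₛ X w) ⇔ (∃ λ i → i ∈ₛ X × AcceptsFrom (decode i) w)
    subset-run []      X = mk⇔ (λ f → f) (λ f → f)
    subset-run (a ∷ w) X = mk⇔ ⇒ ⇐ ⇔-∘ subset-run w (stepₛ X a)
      where
      ⇒ : (∃ λ j → j ∈ₛ stepₛ X a × AcceptsFrom (decode j) w) → ∃ λ i → i ∈ₛ X × AcceptsFrom (decode i) (a ∷ w)
      ⇒ (j , j∈ , accept) with ∈⟦⟧⁻ (successor? X a) j∈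
      ... | i , i∈X , edge = i , i∈X , decode j , edge , accept
      ⇐ : (∃ λ i → i ∈ₛ X × AcceptsFrom (decode i) (a ∷ w)) → ∃ λ j → j ∈ₛ stepₛ X a × AcceptsFrom (decode j) w
      ⇐ (i , i∈X , t , edge , accept) = encode t ,
        ∈⟦⟧⁺ (successor? X a) (i , i∈X , subst (Edge (decode i) a) (sym (decode-encode t)) edge) ,
        subst (λ s → AcceptsFrom s w) (sym (decode-encode t)) accept

  recogniser : ∀ {P} → (∀ w → AcceptsFrom start w ⇔ P (fromDigits w)) → Recogniser k P
  recogniser correct = finite-state (Subset↪Fin N) ⁅ encode start ⁆ stepₛ
    (λ X → any? λ i → (i ∈? X) ×-dec final? (decode i))
    (λ w → correct w ⇔-∘ (mk⇔ (only w) (λ accept → encode start , x∈⁅x⁆ _ ,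
                            subst (λ s → AcceptsFrom s w) (sym (decode-encode start)) accept)
                          ⇔-∘ subset-run w ⁅ encode start ⁆))
    where
    only : ∀ w → (∃ λ i → i ∈ₛ ⁅ encode start ⁆ × AcceptsFrom (decode i) w) → AcceptsFrom start w
    only w (i , i∈ , accept) with x∈⁅y⁆⇒x≡y (encode start) i∈
    ... | refl = subst (λ s → AcceptsFrom s w) (decode-encode start) accept

-- Automata for sums

_⊕_ : Pred ℕ 0ℓ → Pred ℕ 0ℓ → Pred ℕ 0ℓ
(P ⊕ Q) n = ∃₂ λ x y → P x × Q y × x + y ≡ n

-- The carry tells whether `a + b + c` reaches `k`. It is at most 1 because `a + b + 1 < k + k`;
-- uniqueness of division with remainder then matches the low digits and the rests separately.
add-with-carry : ∀ {k} (a b d : Fin k) (c : Fin 2) x y z →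
  (toℕ a + x * k) + (toℕ b + y * k) + toℕ c ≡ toℕ d + z * k →
  Σ[ c′ ∈ Fin 2 ] toℕ a + toℕ b + toℕ c ≡ toℕ d + toℕ c′ * k × x + y + toℕ c′ ≡ z
add-with-carry {k} a b d c x y z eq with toℕ a + toℕ b + toℕ c <? k
... | yes s<k with digit-unique (x + y) z s<k (toℕ<n d) (trans (regroup (toℕ a) (toℕ b) (toℕ c) x y k) eq)
  where
  regroup : ∀ a b c x y k → a + b + c + (x + y) * k ≡ (a + x * k) + (b + y * k) + c
  regroup = solve-∀
...   | s≡d , x+y≡z = zero , trans s≡d (sym (+-identityʳ _)) , trans (+-identityʳ _) x+y≡z
add-with-carry {k} a b d c x y z eq | no s≮k
  with digit-unique (x + y + 1) z r<k (toℕ<n d)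
    (trans (regroup (s ∸ k) k x y) (trans (cong (_+ (x + y) * k) s≡)
      (trans (regroup′ (toℕ a) (toℕ b) (toℕ c) x y k) eq)))
  where
  s = toℕ a + toℕ b + toℕ c
  s≡ : s ∸ k + k ≡ s
  s≡ = m∸n+n≡m (≮⇒≥ s≮k)
  regroup : ∀ r k x y → r + (x + y + 1) * k ≡ r + k + (x + y) * k
  regroup = solve-∀
  regroup′ : ∀ a b c x y k → a + b + c + (x + y) * k ≡ (a + x * k) + (b + y * k) + c
  regroup′ = solve-∀
  r<k : s ∸ k < k
  r<k = +-cancelʳ-< k (s ∸ k) k (begin-strict
    s ∸ k + k               ≡⟨ s≡ ⟩
    toℕ a + toℕ b + toℕ c   ≤⟨ +-monoʳ-≤ (toℕ a + toℕ b) (s≤s⁻¹ (toℕ<n c)) ⟩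
    toℕ a + toℕ b + 1       ≡⟨ +-assoc (toℕ a) (toℕ b) 1 ⟩
    toℕ a + (toℕ b + 1)     ≡⟨ cong (toℕ a +_) (+-comm (toℕ b) 1) ⟩
    toℕ a + suc (toℕ b)     <⟨ +-mono-<-≤ (toℕ<n a) (toℕ<n b) ⟩
    k + k                   ∎)
    where open ≤-Reasoning
... | r≡d , x+y+1≡z = suc zero ,
  trans (sym (m∸n+n≡m (≮⇒≥ s≮k))) (cong₂ _+_ r≡d (sym (+-identityʳ k))) , x+y+1≡z

module _ {k : ℕ} .{{_ : NonZero k}} where

  -- Schoolbook addition in reverse: the digits of the sum are read, those of the two summands are
  -- guessed, and the state remembers the carry. Reading the least significant digit first makes the
  -- carry move along with the run.
  Recogniser-⊕ : ∀ {P Q} → Recogniser k P → Recogniser k Q → Recogniser k (P ⊕ Q)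
  Recogniser-⊕ {P} {Q} R₁ R₂ = recogniser correct
    where
    open Recogniser R₁ renaming (dfa to M₁; correct to correct₁)
    open Recogniser R₂ renaming (dfa to M₂; correct to correct₂)
    open DFA M₁ renaming (size to size₁; start to start₁; step to step₁; accepting to accepting₁)
    open DFA M₂ renaming (size to size₂; start to start₂; step to step₂; accepting to accepting₂)

    State = Fin size₁ × Fin size₂ × Fin 2

    Edge : State → Fin k → State → Set
    Edge (p , q , c) d (p′ , q′ , c′) =
      ∃₂ λ a b → step₁ p a ≡ p′ × step₂ q b ≡ q′ × toℕ a + toℕ b + toℕ c ≡ toℕ d + toℕ c′ * k

    Final : Pred State 0ℓ
    Final (p , q , c) = p ∈ₛ accepting₁ × q ∈ₛ accepting₂ × toℕ c ≡ 0

    open Nondeterministic (×↪Fin (×↪Fin (↔⇒↪ (↔-id (Fin 2))))) (start₁ , start₂ , zero)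
      {Edge} (λ _ _ _ → any? λ a → any? λ b → (_ Fin.≟ _) ×-dec (_ Fin.≟ _) ×-dec (_ ≟ _))
      {Final} (λ _ → (_ ∈? _) ×-dec (_ ∈? _) ×-dec (_ ≟ _))

    -- Stated for every state, with `c` the carry from lower digits, so that it can be proved by
    -- induction on the word.
    Guess : State → List (Fin k) → Set
    Guess (p , q , c) w = ∃₂ λ (u v : List (Fin k)) → length u ≡ length w × length v ≡ length w ×
      foldl step₁ p u ∈ₛ accepting₁ × foldl step₂ q v ∈ₛ accepting₂ ×
      fromDigits u + fromDigits v + toℕ c ≡ fromDigits w

    guess⁺ : ∀ w s → AcceptsFrom s w → Guess s w
    guess⁺ []      (p , q , c) (p∈ , q∈ , c≡0) = [] , [] , refl , refl , p∈ , q∈ , c≡0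
    guess⁺ (d ∷ w) (p , q , c) ((_ , _ , c′) , (a , b , refl , refl , eq) , accept)
      with guess⁺ w _ accept
    ... | u , v , ∣u∣ , ∣v∣ , p∈ , q∈ , eq′ = a ∷ u , b ∷ v , cong suc ∣u∣ , cong suc ∣v∣ , p∈ , q∈ , (begin
      (toℕ a + U * k) + (toℕ b + V * k) + toℕ c      ≡⟨ regroup₁ (toℕ a) (toℕ b) (toℕ c) U V k ⟩
      toℕ a + toℕ b + toℕ c + (U + V) * k            ≡⟨ cong (_+ (U + V) * k) eq ⟩
      toℕ d + toℕ c′ * k + (U + V) * k               ≡⟨ regroup₂ (toℕ d) (toℕ c′) U V k ⟩
      toℕ d + (U + V + toℕ c′) * k                   ≡⟨ cong (λ □ → toℕ d + □ * k) eq′ ⟩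
      toℕ d + fromDigits w * k                       ∎)
      where
      open ≡-Reasoning
      U = fromDigits u
      V = fromDigits v
      regroup₁ : ∀ a b c U V k → (a + U * k) + (b + V * k) + c ≡ a + b + c + (U + V) * k
      regroup₁ = solve-∀
      regroup₂ : ∀ d c U V k → d + c * k + (U + V) * k ≡ d + (U + V + c) * k
      regroup₂ = solve-∀

    guess⁻ : ∀ w s → Guess s w → AcceptsFrom s w
    guess⁻ []      s           ([] , [] , _ , _ , p∈ , q∈ , c≡0) = p∈ , q∈ , c≡0
    guess⁻ (d ∷ w) (p , q , c) (a ∷ u , b ∷ v , ∣u∣ , ∣v∣ , p∈ , q∈ , eq)
      with add-with-carry a b d c (fromDigits u) (fromDigits v) (fromDigits w) eq
    ... | c′ , eq₀ , eq′ = (_ , _ , c′) , (a , b , refl , refl , eq₀) ,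
      guess⁻ w _ (u , v , suc-injective ∣u∣ , suc-injective ∣v∣ , p∈ , q∈ , eq′)

    correct : ∀ w → AcceptsFrom (start₁ , start₂ , zero) w ⇔ (P ⊕ Q) (fromDigits w)
    correct w = mk⇔ (⇒ ∘ guess⁺ w _) (guess⁻ w _ ∘ ⇐)
      where
      ⇒ : Guess (start₁ , start₂ , zero) w → (P ⊕ Q) (fromDigits w)
      ⇒ (u , v , _ , _ , p∈ , q∈ , eq) =
        _ , _ , to (correct₁ u) p∈ , to (correct₂ v) q∈ , trans (sym (+-identityʳ _)) eq
      ⇐ : (P ⊕ Q) (fromDigits w) → Guess (start₁ , start₂ , zero) w
      -- Summands do not exceed the sum, so both fit into words of its length, padded with leading
      -- zeros.
      ⇐ (x , y , Px , Qy , x+y≡)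
        with digits-of-length k (length w)
               (≤-<-trans (m+n≤o⇒m≤o x (≤-reflexive x+y≡)) (fromDigits<k^length w))
           | digits-of-length k (length w)
               (≤-<-trans (m+n≤o⇒n≤o x (≤-reflexive x+y≡)) (fromDigits<k^length w))
      ... | u , ∣u∣ , refl | v , ∣v∣ , refl =
        u , v , ∣u∣ , ∣v∣ , from (correct₁ u) Px , from (correct₂ v) Qy , trans (+-identityʳ _) x+y≡

  Recogniser-∪ : ∀ {P Q} → Recogniser k P → Recogniser k Q → Recogniser k (λ n → P n ⊎ Q n)
  Recogniser-∪ {P} {Q} R₁ R₂ = finite-state (×↪Fin (↔⇒↪ (↔-id _))) (start₁ , start₂) step
    {Final} (λ _ → (_ ∈? _) ⊎-dec (_ ∈? _))
    λ w → mk⇔ (⇒ w) (⇐ w)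
    where
    open Recogniser R₁ renaming (dfa to M₁; correct to correct₁)
    open Recogniser R₂ renaming (dfa to M₂; correct to correct₂)
    open DFA M₁ renaming (size to size₁; start to start₁; step to step₁; accepting to accepting₁)
    open DFA M₂ renaming (size to size₂; start to start₂; step to step₂; accepting to accepting₂)
    step : Fin size₁ × Fin size₂ → Fin k → Fin size₁ × Fin size₂
    step (p , q) a = step₁ p a , step₂ q a
    Final : Pred (Fin size₁ × Fin size₂) 0ℓ
    Final (p , q) = p ∈ₛ accepting₁ ⊎ q ∈ₛ accepting₂
    run : ∀ w p q → foldl step (p , q) w ≡ (foldl step₁ p w , foldl step₂ q w)
    run []      p q = refl
    run (a ∷ w) p q = run w _ _
    ⇒ : ∀ w → Final (foldl step (start₁ , start₂) w) → P (fromDigits w) ⊎ Q (fromDigits w)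
    ⇒ w = Sum.map (to (correct₁ w)) (to (correct₂ w)) ∘ subst Final (run w start₁ start₂)
    ⇐ : ∀ w → P (fromDigits w) ⊎ Q (fromDigits w) → Final (foldl step (start₁ , start₂) w)
    ⇐ w = subst Final (sym (run w start₁ start₂)) ∘ Sum.map (from (correct₁ w)) (from (correct₂ w))

  Recogniser-0 : Recogniser k (_≡ 0)
  Recogniser-0 = record
    { dfa     = record { size = 2 ; start = zero ; step = step ; accepting = ⁅ zero ⁆ }
    ; correct = λ w → mk⇔ (⇒ w ∘ x∈⁅y⁆⇒x≡y zero) (λ eq → subst (_∈ₛ ⁅ zero ⁆) (sym (⇐ w eq)) (x∈⁅x⁆ zero)) }
    where
    step : Fin 2 → Fin k → Fin 2
    step (suc q) a = suc q
    step zero    a with toℕ a ≟ 0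
    ... | yes _ = zero
    ... | no  _ = suc zero
    stuck : ∀ w → foldl step (suc zero) w ≡ suc zero
    stuck []      = refl
    stuck (a ∷ w) = stuck w
    ⇒ : ∀ w → foldl step zero w ≡ zero → fromDigits w ≡ 0
    ⇒ []      _ = refl
    ⇒ (a ∷ w) eq with toℕ a ≟ 0
    ... | yes a≡0 = cong₂ (λ □ ■ → □ + ■ * k) a≡0 (⇒ w eq)
    ... | no  _   with trans (sym (stuck w)) eq
    ...   | ()
    ⇐ : ∀ w → fromDigits w ≡ 0 → foldl step zero w ≡ zero
    ⇐ []      _ = refl
    ⇐ (a ∷ w) eq with toℕ a ≟ 0
    ... | yes _   = ⇐ w (m*n≡0⇒m≡0 (fromDigits w) k (m+n≡0⇒n≡0 (toℕ a) eq))
    ... | no a≢0 = contradiction (m+n≡0⇒m≡0 (toℕ a) eq) a≢0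

  -- An absent summand is counted as 0: one more summand means adding an element of S ∪ {0}.
  Recogniser-SumOfAtMost : ∀ {S} → Recogniser k S → ∀ j → Recogniser k (SumOfAtMost j S)
  Recogniser-SumOfAtMost R zero = Recogniser-⇔ (λ n → mk⇔
    (λ { refl → [] , z≤n , [] , refl })
    (λ { ([] , _ , _ , refl) → refl })) Recogniser-0
  Recogniser-SumOfAtMost {S} R (suc j) =
    Recogniser-⇔ (λ n → mk⇔ ⇒ ⇐) (Recogniser-⊕ (Recogniser-∪ Recogniser-0 R) (Recogniser-SumOfAtMost R j))
    where
    ⇒ : ∀ {n} → ((λ x → x ≡ 0 ⊎ S x) ⊕ SumOfAtMost j S) n → SumOfAtMost (suc j) S n
    ⇒ (x , _ , inj₁ refl , (xs , ≤j , Sxs , refl) , refl) = xs , m≤n⇒m≤1+n ≤j , Sxs , refl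
    ⇒ (x , _ , inj₂ Sx   , (xs , ≤j , Sxs , refl) , refl) = x ∷ xs , s≤s ≤j , Sx ∷ Sxs , refl
    ⇐ : ∀ {n} → SumOfAtMost (suc j) S n → ((λ x → x ≡ 0 ⊎ S x) ⊕ SumOfAtMost j S) n
    ⇐ ([]     , _      , []       , refl) = 0 , 0 , inj₁ refl , ([] , z≤n , [] , refl) , refl
    ⇐ (x ∷ xs , s≤s ≤j , Sx ∷ Sxs , refl) = x , _ , inj₂ Sx   , (xs , ≤j , Sxs , refl) , refl

-- Canonical words

-- Words are least significant first, so a zero digit is a leading zero exactly when nothing remains
-- after it.
prepend : ∀ {k} → Fin k → List (Fin k) → List (Fin k)
prepend a (b ∷ t) = a ∷ b ∷ t
prepend a []      = if toℕ a ≡ᵇ 0 then [] else a ∷ []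

trim : ∀ {k} → List (Fin k) → List (Fin k)
trim []      = []
trim (a ∷ w) = prepend a (trim w)

fromDigits-prepend : ∀ {k} (a : Fin k) t → fromDigits (prepend a t) ≡ toℕ a + fromDigits t * k
fromDigits-prepend a (b ∷ t) = refl
fromDigits-prepend a [] with toℕ a in eq
... | zero  = refl
... | suc _ = cong (_+ 0) eq

fromDigits-trim : ∀ {k} (w : List (Fin k)) → fromDigits (trim w) ≡ fromDigits w
fromDigits-trim     []      = refl
fromDigits-trim {k} (a ∷ w) =
  trans (fromDigits-prepend a (trim w)) (cong (λ □ → toℕ a + □ * k) (fromDigits-trim w))

prepend-NoLeadingZeros : ∀ {k} (a : Fin k) t → NoLeadingZeros t → NoLeadingZeros (prepend a t)
prepend-NoLeadingZeros a (b ∷ t) nlz = nlz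
prepend-NoLeadingZeros a [] nlz with toℕ a in eq
... | zero  = Maybe.nothing
... | suc _ = Maybe.just λ a≡0 → 0≢1+n (trans (sym a≡0) eq)

trim-NoLeadingZeros : ∀ {k} (w : List (Fin k)) → NoLeadingZeros (trim w)
trim-NoLeadingZeros []      = Maybe.nothing
trim-NoLeadingZeros (a ∷ w) = prepend-NoLeadingZeros a (trim w) (trim-NoLeadingZeros w)

prepend-zero : ∀ {k} {a : Fin k} → toℕ a ≡ 0 → prepend a [] ≡ []
prepend-zero a≡0 rewrite a≡0 = refl

trim-zero : ∀ {k} .{{_ : NonZero k}} (w : List (Fin k)) → fromDigits w ≡ 0 → trim w ≡ []
trim-zero     []      _  = refl
trim-zero {k} (a ∷ w) eq = trans
  (cong (prepend a) (trim-zero w (m*n≡0⇒m≡0 (fromDigits w) k (m+n≡0⇒n≡0 (toℕ a) eq))))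
  (prepend-zero (m+n≡0⇒m≡0 (toℕ a) eq))

trim-unique : ∀ {k} .{{_ : NonZero k}} (v w : List (Fin k)) → fromDigits v ≡ fromDigits w → trim v ≡ trim w
trim-unique []      w       eq = sym (trim-zero w (sym eq))
trim-unique (a ∷ v) []      eq = trim-zero (a ∷ v) eq
trim-unique (a ∷ v) (b ∷ w) eq with digit-unique (fromDigits v) (fromDigits w) (toℕ<n a) (toℕ<n b) eq
... | a≡b , eq′ = cong₂ prepend (toℕ-injective a≡b) (trim-unique v w eq′)

module _ {k : ℕ} .{{_ : NonZero k}} (M : DFA k) where
  open DFA M

  -- The algorithm sees only `M`, which may accept words with leading zeros and so recognise no set.
  -- This set is defined for every `M` and agrees with `S` whenever `M` recognises `S`.
  Members : Pred ℕ 0ℓ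
  Members n = ∃ λ w → fromDigits w ≡ n × Accepts M (trim w)

  -- The second component is the state reached at the last nonzero digit.
  Recogniser-Members : Recogniser k Members
  Recogniser-Members = finite-state (×↪Fin (↔⇒↪ (↔-id _))) (start , start) stepₜ
    {λ (p , q) → q ∈ₛ accepting} (λ _ → _ ∈? _) λ w → mk⇔
      (λ q∈ → w , refl , subst (_∈ₛ accepting) (trans (run w start start) (at-start (trim w))) q∈)
      (λ (v , eq , accept) → subst (_∈ₛ accepting)
        (trans (cong (foldl step start) (trim-unique v w eq))
          (sym (trans (run w start start) (at-start (trim w))))) accept)
    where
    stepₜ : Fin size × Fin size → Fin k → Fin size × Fin size
    stepₜ (p , q) a = step p a , (if toℕ a ≡ᵇ 0 then q else step p a)
    -- `q` is the answer if the rest of the word trims to nothing; otherwise the run continues from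
    -- `p`.
    after : Fin size → Fin size → List (Fin k) → Fin size
    after p q []      = q
    after p q (a ∷ t) = foldl step p (a ∷ t)
    at-start : ∀ t → after start start t ≡ foldl step start t
    at-start []      = refl
    at-start (_ ∷ _) = refl
    after-prepend : ∀ p q a t →
      after (step p a) (if toℕ a ≡ᵇ 0 then q else step p a) t ≡ after p q (prepend a t)
    after-prepend p q a (b ∷ t) = refl
    after-prepend p q a [] with toℕ a
    ... | zero  = refl
    ... | suc _ = refl
    run : ∀ w p q → proj₂ (foldl stepₜ (p , q) w) ≡ after p q (trim w)
    run []      p q = refl
    run (a ∷ w) p q = trans (run w _ _) (after-prepend p q a (trim w))

  Recognises⇒Members : 2 ≤ k → ∀ {S} → M Recognises S → ∀ n → S n ⇔ Members n
  Recognises⇒Members 2≤k {S} recognises n = mk⇔ ⇒ ⇐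
    where
    ⇒ : S n → Members n
    ⇒ Sn with digits-of-length k n (n<b^n k n 2≤k)
    ... | w , _ , eq = w , eq , from (recognises (trim w)) (n , Sn , trans (fromDigits-trim w) eq , trim-NoLeadingZeros w)
    ⇐ : Members n → S n
    ⇐ (w , eq , accept) with to (recognises (trim w)) accept
    ... | m , Sm , eq′ , _ = subst S (trans (sym eq′) (trans (fromDigits-trim w) eq)) Sm

-- Reachability

-- Warshall's algorithm: Via vs p q allows only the vertices of vs in the interior of a path.
module _ {n} {E : Rel (Fin n) 0ℓ} (E? : Decidable₂ E) where

  private
    Via : List (Fin n) → Rel (Fin n) 0ℓ
    Via []       p q = p ≡ q ⊎ E p q
    Via (v ∷ vs) p q = Via vs p q ⊎ Via vs p v × Via vs v q

    via? : ∀ vs → Decidable₂ (Via vs)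
    via? []       p q = (p Fin.≟ q) ⊎-dec E? p q
    via? (v ∷ vs) p q = via? vs p q ⊎-dec via? vs p v ×-dec via? vs v q

    via-direct : ∀ vs {p q} → p ≡ q ⊎ E p q → Via vs p q
    via-direct []       e = e
    via-direct (v ∷ vs) e = inj₁ (via-direct vs e)

    via-trans : ∀ vs {p v q} → v ∈ vs → Via vs p v → Via vs v q → Via vs p q
    via-trans (_ ∷ vs) (here refl) (inj₁ x)       (inj₁ y)       = inj₂ (x , y)
    via-trans (_ ∷ vs) (here refl) (inj₁ x)       (inj₂ (_ , y)) = inj₂ (x , y)
    via-trans (_ ∷ vs) (here refl) (inj₂ (x , _)) (inj₁ y)       = inj₂ (x , y)
    via-trans (_ ∷ vs) (here refl) (inj₂ (x , _)) (inj₂ (_ , y)) = inj₂ (x , y)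
    via-trans (_ ∷ vs) (there v∈)  (inj₁ x)       (inj₁ y)       = inj₁ (via-trans vs v∈ x y)
    via-trans (_ ∷ vs) (there v∈)  (inj₁ x)       (inj₂ (y , z)) = inj₂ (via-trans vs v∈ x y , z)
    via-trans (_ ∷ vs) (there v∈)  (inj₂ (x , y)) (inj₁ z)       = inj₂ (x , via-trans vs v∈ y z)
    via-trans (_ ∷ vs) (there v∈)  (inj₂ (x , _)) (inj₂ (_ , y)) = inj₂ (x , y)

    via⇒star : ∀ vs {p q} → Via vs p q → Star E p q
    via⇒star []       (inj₁ refl)    = ε
    via⇒star []       (inj₂ e)       = e ◅ ε
    via⇒star (_ ∷ vs) (inj₁ x)       = via⇒star vs x
    via⇒star (_ ∷ vs) (inj₂ (x , y)) = via⇒star vs x ◅◅ via⇒star vs y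

    star⇒via : ∀ {p q} → Star E p q → Via (allFin n) p q
    star⇒via ε       = via-direct _ (inj₁ refl)
    star⇒via (e ◅ s) = via-trans _ (∈-allFin _) (via-direct _ (inj₂ e)) (star⇒via s)

  star? : Decidable₂ (Star E)
  star? p q = map′ (via⇒star _) star⇒via (via? (allFin n) p q)

fromDigits-++-≥ : ∀ {k} .{{_ : NonZero k}} (u w : List (Fin k)) → fromDigits w ≤ fromDigits (u ++ w)
fromDigits-++-≥     []      w = ≤-refl
fromDigits-++-≥ {k} (a ∷ u) w = begin
  fromDigits w                     ≤⟨ fromDigits-++-≥ u w ⟩
  fromDigits (u ++ w)              ≤⟨ m≤m*n _ k ⟩
  fromDigits (u ++ w) * k          ≤⟨ m≤n+m _ (toℕ a) ⟩
  toℕ a + fromDigits (u ++ w) * k  ∎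
  where open ≤-Reasoning

module Reachability {k} (M : DFA k) where
  open DFA M

  infixl 5 _·_
  _·_ : Fin size → List (Fin k) → Fin size
  _·_ = foldl step

  Reach : Rel (Fin size) 0ℓ
  Reach p q = ∃ λ w → p · w ≡ q

  reach-trans : ∀ {p q r} → Reach p q → Reach q r → Reach p r
  reach-trans {p} (u , refl) (v , refl) = u ++ v , foldl-++ step p u v

  abstract
    reach? : Decidable₂ Reach
    reach? p q = map′ ⇒ ⇐ (star? (λ p q → any? λ a → step p a Fin.≟ q) p q)
      where
      Edge : Rel (Fin size) 0ℓ
      Edge p q = ∃ λ a → step p a ≡ q
      ⇒ : ∀ {p q} → Star Edge p q → Reach p q
      ⇒ ε              = [] , refl
      ⇒ ((a , refl) ◅ s) with ⇒ s
      ... | w , eq = a ∷ w , eq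
      ⇐ : ∀ {p q} → Reach p q → Star Edge p q
      ⇐ ([]    , refl) = ε
      ⇐ (a ∷ w , eq)   = (a , refl) ◅ ⇐ (w , eq)

    -- Constant on strongly connected components and strictly smaller once a component is left. It
    -- is the termination measure for `settle` and the degree of the polynomial in the sparse case.
    rank : Fin size → ℕ
    rank p = ∣ ⟦ reach? p ⟧ ∣

    rank≥1 : ∀ p → 1 ≤ rank p
    rank≥1 p = subst (_≤ rank p) (∣⁅x⁆∣≡1 p) (p⊆q⇒∣p∣≤∣q∣ {p = ⁅ p ⁆} λ {q} q∈ →
      ∈⟦⟧⁺ (reach? p) ([] , sym (x∈⁅y⁆⇒x≡y p q∈)))

    rank-mono : ∀ {p q} → Reach p q → rank q ≤ rank p
    rank-mono {p} {q} p→q = p⊆q⇒∣p∣≤∣q∣ λ r∈ → ∈⟦⟧⁺ (reach? p) (reach-trans p→q (∈⟦⟧⁻ (reach? q) r∈))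

    rank-strict : ∀ {p q} → Reach p q → ¬ Reach q p → rank q < rank p
    rank-strict {p} {q} p→q ¬q→p = p⊂q⇒∣p∣<∣q∣
      ( (λ r∈ → ∈⟦⟧⁺ (reach? p) (reach-trans p→q (∈⟦⟧⁻ (reach? q) r∈)))
      , p , ∈⟦⟧⁺ (reach? p) ([] , refl) , ¬q→p ∘ ∈⟦⟧⁻ (reach? q))

    rank≤size : ∀ p → rank p ≤ size
    rank≤size p = ∣p∣≤n ⟦ reach? p ⟧

-- Deciding whether all, or almost all, numbers are accepted

module _ {k} {P : Pred ℕ 0ℓ} (R : Recogniser k P) (2≤k : 2 ≤ k) where
  open Recogniser R
  open DFA dfa
  open Reachability dfa

  private instance
    _ : NonZero k
    _ = >-nonZero (≤-trans (s≤s z≤n) 2≤k)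

  -- Every word represents a number here, so each reachable rejecting state is a counterexample.
  universal? : Dec (∀ n → P n)
  universal? = map′ ⇒ ⇐ (¬? (any? λ q → reach? start q ×-dec ¬? (q ∈? accepting)))
    where
    ⇒ : ¬ (∃ λ q → Reach start q × q ∉ₛ accepting) → ∀ n → P n
    ⇒ none n with digits-of-length k n (n<b^n k n 2≤k)
    ... | w , _ , refl = to (correct w) (decidable-stable (_ ∈? _) λ reject → none (_ , (w , refl) , reject))
    ⇐ : (∀ n → P n) → ¬ (∃ λ q → Reach start q × q ∉ₛ accepting)
    ⇐ all (_ , (w , refl) , reject) = reject (from (correct w) (all _))

  private
    -- Positive value is demanded so that a loop in front of the word yields larger numbers even if
    -- it reads only zeros.
    Bad : Pred (Fin size) 0ℓ
    Bad p = ∃ λ w → 0 < fromDigits w × p · w ∉ₛ accepting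

    -- A word has positive value when some letter is nonzero; splitting it at such a letter leaves
    -- two reachability questions.
    bad? : Decidable Bad
    bad? p = map′ ⇒ (λ (w , pos , reject) → ⇐ p w pos reject)
      (any? λ q → any? λ a → any? λ f →
        reach? p q ×-dec ¬? (toℕ a ≟ 0) ×-dec reach? (step q a) f ×-dec ¬? (f ∈? accepting))
      where
      Split : Pred (Fin size) 0ℓ
      Split p = ∃ λ q → ∃₂ λ a f → Reach p q × toℕ a ≢ 0 × Reach (step q a) f × f ∉ₛ accepting
      ⇒ : Split p → Bad p
      ⇒ (_ , a , _ , (u , refl) , a≢0 , (v , refl) , reject) = u ++ a ∷ v ,
        ≤-trans (≤-trans (n≢0⇒n>0 a≢0) (m≤m+n (toℕ a) _)) (fromDigits-++-≥ u (a ∷ v)) ,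
        subst (_∉ₛ accepting) (sym (foldl-++ step p u (a ∷ v))) reject
      ⇐ : ∀ p w → 0 < fromDigits w → p · w ∉ₛ accepting → Split p
      ⇐ p (a ∷ w) pos reject with toℕ a ≟ 0
      ... | no a≢0 = p , a , _ , ([] , refl) , a≢0 , (w , refl) , reject
      ... | yes a≡0 with ⇐ (step p a) w
            (n≢0⇒n>0 λ w≡0 → <⇒≢ pos (sym (cong₂ (λ □ ■ → □ + ■ * k) a≡0 w≡0))) reject
      ...   | q , b , f , p→q , rest = q , b , f , reach-trans (a ∷ [] , refl) p→q , rest

    bad-pullback : ∀ {p q} → Reach p q → Bad q → Bad p
    bad-pullback {p} (u , refl) (w , pos , reject) = u ++ w , ≤-trans pos (fromDigits-++-≥ u w) ,
      subst (_∉ₛ accepting) (sym (foldl-++ step p u w)) reject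

    Cyclic : Pred (Fin size) 0ℓ
    Cyclic p = ∃ λ a → Reach (step p a) p

    -- A turn of the cycle puts at least one low digit in front, which multiplies the value by at
    -- least `k`.
    pump : ∀ {p} → Bad p → Cyclic p → ∀ i → ∃ λ w → i < fromDigits w × p · w ∉ₛ accepting
    pump bad cyclic zero = bad
    pump {p} bad (a , u , loop) (suc i) with pump bad (a , u , loop) i
    ... | w , i<w , reject = a ∷ u ++ w , (begin-strict
      suc i                             ≤⟨ i<w ⟩
      fromDigits w                      <⟨ m<m*n (fromDigits w) k {{>-nonZero (≤-<-trans z≤n i<w)}} 2≤k ⟩
      fromDigits w * k                  ≤⟨ *-monoˡ-≤ k (fromDigits-++-≥ u w) ⟩
      fromDigits (u ++ w) * k           ≤⟨ m≤n+m _ (toℕ a) ⟩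
      toℕ a + fromDigits (u ++ w) * k   ∎) ,
      subst (_∉ₛ accepting) (sym (trans (foldl-++ step (step p a) u w) (cong (_· w) loop))) reject
      where open ≤-Reasoning

    -- Every step out of a bad state that lies on no cycle loses rank.
    settle : (∀ p → Reach start p → Bad p → ¬ Cyclic p) →
             ∀ w p → Reach start p → rank p ≤ length w → ¬ Bad (p · w)
    settle acyclic []      p s→p rank≤ bad = contradiction (≤-trans (rank≥1 p) rank≤) λ ()
    settle acyclic (a ∷ w) p s→p rank≤ bad =
      settle acyclic w (step p a) (reach-trans s→p (a ∷ [] , refl)) (s≤s⁻¹ (≤-trans smaller rank≤)) bad
      where
      smaller : rank (step p a) < rank p
      smaller = rank-strict (a ∷ [] , refl) λ back →
        acyclic p s→p (bad-pullback (a ∷ w , refl) bad) (a , back)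

  -- The obstruction is a reachable bad state on a cycle. Without one, `size` low digits exhaust the
  -- rank and lead to a state that is not bad; for `n ≥ k ^ size` the remaining high part is
  -- nonzero, hence accepted.
  cofinite? : Dec (∃ λ N → ∀ n → N ≤ n → P n)
  cofinite? = map′ ⇒ ⇐ (¬? (any? λ p → reach? start p ×-dec bad? p ×-dec any? λ a → reach? (step p a) p))
    where
    ⇒ : ¬ (∃ λ p → Reach start p × Bad p × Cyclic p) → ∃ λ N → ∀ n → N ≤ n → P n
    ⇒ none = k ^ size , λ n k^s≤n → eventually n k^s≤n
      where
      eventually : ∀ n → k ^ size ≤ n → P n
      eventually n k^s≤n with low-digits k size n
      ... | u , ∣u∣ , n′ , refl with digits-of-length k n′ (n<b^n k n′ 2≤k)
      ...   | v , _ , refl = subst P (trans (fromDigits-++ u v) (cong (λ □ → fromDigits u + fromDigits v * k ^ □) ∣u∣))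
        (to (correct (u ++ v)) (decidable-stable (_ ∈? _) λ reject →
          settle (λ p s→p bad cyclic → none (p , s→p , bad , cyclic)) u start ([] , refl)
            (≤-trans (rank≤size start) (≤-reflexive (sym ∣u∣)))
            (v , n≢0⇒n>0 v≢0 , reject ∘ subst (_∈ₛ accepting) (sym (foldl-++ step start u v)))))
        where
        v≢0 : fromDigits v ≢ 0
        v≢0 v≡0 = <⇒≱ (fromDigits<k^length u)
          (subst (λ □ → k ^ □ ≤ fromDigits u) (sym ∣u∣)
            (≤-trans k^s≤n (≤-reflexive (trans (cong (λ □ → fromDigits u + □ * k ^ size) v≡0) (+-identityʳ _)))))
    ⇐ : (∃ λ N → ∀ n → N ≤ n → P n) → ¬ (∃ λ p → Reach start p × Bad p × Cyclic p)
    ⇐ (N , eventually) (p , (u , refl) , bad , cyclic) with pump bad cyclic N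
    ... | w , N<w , reject = reject (subst (_∈ₛ accepting) (foldl-++ step start u w)
      (from (correct (u ++ w)) (eventually _ (≤-trans (<⇒≤ N<w) (fromDigits-++-≥ u w)))))

-- The sparse case

concat-tabulate-≤ : ∀ {A : Set} {n} (f : Fin n → List A) {Z} → (∀ a → length (f a) ≤ Z) →
                    length (concat (tabulate f)) ≤ n * Z
concat-tabulate-≤ {n = zero}  f ≤Z = z≤n
concat-tabulate-≤ {n = suc n} f ≤Z = ≤-trans (≤-reflexive (length-++ (f zero)))
  (+-mono-≤ (≤Z zero) (concat-tabulate-≤ (f ∘ suc) (≤Z ∘ suc)))

concat-tabulate-≤-except : ∀ {A : Set} {n} (f : Fin n → List A) {Y Z} a₀ → length (f a₀) ≤ Y →
                           (∀ a → a ≢ a₀ → length (f a) ≤ Z) → length (concat (tabulate f)) ≤ Y + n * Z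
concat-tabulate-≤-except {n = suc n} f {Y} {Z} zero ≤Y ≤Z = begin
  length (f zero ++ rest)       ≡⟨ length-++ (f zero) ⟩
  length (f zero) + length rest ≤⟨ +-mono-≤ ≤Y (concat-tabulate-≤ (f ∘ suc) (λ a → ≤Z (suc a) λ ())) ⟩
  Y + n * Z                     ≤⟨ +-monoʳ-≤ Y (m≤n+m (n * Z) Z) ⟩
  Y + suc n * Z                 ∎
  where
  open ≤-Reasoning
  rest = concat (tabulate (f ∘ suc))
concat-tabulate-≤-except {n = suc n} f {Y} {Z} (suc a₀) ≤Y ≤Z = begin
  length (f zero ++ rest)       ≡⟨ length-++ (f zero) ⟩
  length (f zero) + length rest ≤⟨ +-mono-≤ (≤Z zero λ ()) others ⟩
  Z + (Y + n * Z)               ≡⟨ regroup Z Y n ⟩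
  Y + suc n * Z                 ∎
  where
  open ≤-Reasoning
  rest = concat (tabulate (f ∘ suc))
  others : length rest ≤ Y + n * Z
  others = concat-tabulate-≤-except (f ∘ suc) a₀ ≤Y λ a a≢a₀ → ≤Z (suc a) (a≢a₀ ∘ Fin.suc-injective)
  regroup : ∀ Z Y n → Z + (Y + n * Z) ≡ Y + suc n * Z
  regroup = solve-∀

module _ {k} (M : DFA k) where
  open DFA M
  open Reachability M

  Branching : Set
  Branching = ∃ λ q → Reach start q × (∃ λ f → Reach q f × f ∈ₛ accepting) ×
              ∃₂ λ a b → a ≢ b × Reach (step q a) q × Reach (step q b) q

  branching? : Dec Branching
  branching? = any? λ q → reach? start q ×-dec (any? λ f → reach? q f ×-dec (f ∈? accepting)) ×-dec
    any? λ a → any? λ b → ¬? (a Fin.≟ b) ×-dec reach? (step q a) q ×-dec reach? (step q b) q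

  -- Words of exact length `m` are counted, leading zeros included, so that members below `k ^ m`
  -- all appear at the same level.
  values : Fin size → ℕ → List ℕ
  values q zero    = if does (q ∈? accepting) then 0 ∷ [] else []
  values q (suc m) = concat (tabulate λ a → map (λ v → toℕ a + v * k) (values (step q a) m))

  ∈-values : ∀ w q → q · w ∈ₛ accepting → fromDigits w ∈ values q (length w)
  ∈-values []      q q∈ with q ∈? accepting
  ... | yes _  = here refl
  ... | no q∉ = contradiction q∈ q∉
  ∈-values (a ∷ w) q q∈ = ∈-concat⁺′ (∈-map⁺ (λ v → toℕ a + v * k) (∈-values w (step q a) q∈)) (∈-tabulate⁺ a)

  values⇒coreachable : ∀ m q {v} → v ∈ values q m → ∃ λ f → Reach q f × f ∈ₛ accepting
  values⇒coreachable zero q v∈ with q ∈? accepting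
  ... | yes q∈ = q , ([] , refl) , q∈
  values⇒coreachable (suc m) q v∈ with ∈-concat⁻′ _ v∈
  ... | _ , v∈′ , ∈tab with ∈-tabulate⁻ {f = λ a → map (λ v → toℕ a + v * k) (values (step q a) m)} ∈tab
  ... | a , refl with ∈-map⁻ (λ v → toℕ a + v * k) v∈′
  ... | _ , v∈″ , _ with values⇒coreachable m (step q a) v∈″
  ... | f , reach , f∈ = f , reach-trans (a ∷ [] , refl) reach , f∈

  module _ .{{_ : NonZero k}} (¬branching : ¬ Branching) where

    -- At a live state at most one letter returns and keeps the exponent; every other letter lowers
    -- it. With `x = k * (m + 1)` and `r + 1` the rank, this gives `(x + k) * x ^ r`, and `x + k` is
    -- the next base. A dead state lists nothing.
    values-polynomial : ∀ m q → Reach start q → length (values q m) ≤ (k * suc m) ^ rank q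
    values-polynomial zero q _ with q ∈? accepting
    ... | yes _ = m^n>0 (k * 1) {{m*n≢0 k 1}} (rank q)
    ... | no  _ = z≤n
    values-polynomial (suc m) q s→q with any? (λ f → reach? q f ×-dec (f ∈? accepting))
    ... | no dead = subst (λ vs → length vs ≤ (k * suc (suc m)) ^ rank q)
      (sym (empty (values q (suc m)) (dead ∘ values⇒coreachable (suc m) q))) z≤n
      where
      empty : ∀ (vs : List ℕ) → (∀ {v} → ¬ v ∈ vs) → vs ≡ []
      empty []      none = refl
      empty (v ∷ _) none = contradiction (here refl) none
    ... | yes live = ≤-trans count step-up
      where
      x = k * suc m
      instance
        _ : NonZero x
        _ = m*n≢0 k (suc m)
      r = pred (rank q)
      1+r≡rank : suc r ≡ rank q
      1+r≡rank = suc-pred (rank q) {{>-nonZero (rank≥1 q)}}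
      children : ∀ a → length (map (λ v → toℕ a + v * k) (values (step q a) m)) ≤ x ^ rank (step q a)
      children a = ≤-trans (≤-reflexive (length-map _ (values (step q a) m)))
                           (values-polynomial m (step q a) (reach-trans s→q (a ∷ [] , refl)))
      leaving : ∀ a → ¬ Reach (step q a) q → length (map (λ v → toℕ a + v * k) (values (step q a) m)) ≤ x ^ r
      leaving a no-return = ≤-trans (children a) (^-monoʳ-≤ x
        (s≤s⁻¹ (≤-trans (rank-strict (a ∷ [] , refl) no-return) (≤-reflexive (sym 1+r≡rank)))))
      count : length (values q (suc m)) ≤ x ^ suc r + k * x ^ r
      count with any? (λ a → reach? (step q a) q)
      ... | no none = ≤-trans (concat-tabulate-≤ _ (λ a → leaving a (none ∘ (a ,_)))) (m≤n+m _ _)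
      ... | yes (a₀ , return) = concat-tabulate-≤-except _ a₀
        (≤-trans (children a₀) (^-monoʳ-≤ x (≤-trans (rank-mono (a₀ ∷ [] , refl)) (≤-reflexive (sym 1+r≡rank)))))
        λ a a≢a₀ → leaving a λ return′ → ¬branching (q , s→q , live , a , a₀ , a≢a₀ , return′ , return)
      step-up : x ^ suc r + k * x ^ r ≤ (k * suc (suc m)) ^ rank q
      step-up = begin
        x * x ^ r + k * x ^ r        ≡⟨ *-distribʳ-+ (x ^ r) x k ⟨
        (x + k) * x ^ r              ≡⟨ cong (_* x ^ r) (trans (+-comm x k) (sym (*-suc k (suc m)))) ⟩
        k * suc (suc m) * x ^ r      ≤⟨ *-monoʳ-≤ (k * suc (suc m)) (^-monoˡ-≤ r (*-monoʳ-≤ k (n≤1+n (suc m)))) ⟩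
        (k * suc (suc m)) ^ suc r    ≡⟨ cong ((k * suc (suc m)) ^_) 1+r≡rank ⟩
        (k * suc (suc m)) ^ rank q   ∎
        where open ≤-Reasoning

All-below-sum : ∀ {P Q : Pred ℕ 0ℓ} {B} → (∀ x → x < B → P x → Q x) → ∀ xs → sum xs < B → All P xs → All Q xs
All-below-sum P⇒Q []       _  []         = []
All-below-sum P⇒Q (x ∷ xs) <B (Px ∷ Pxs) =
  P⇒Q x (≤-<-trans (m≤m+n x _) <B) Px ∷ All-below-sum P⇒Q xs (≤-<-trans (m≤n+m _ x) <B) Pxs

-- Summands of a number below `k ^ m` lie below `k ^ m` and so in `V`. For large `m`, the sums of at
-- most `j` entries of `V` are too few to fill the interval from `N` to `k ^ m`.
sparse⇒¬asymptotic-basis : ∀ {k P} (R : Recogniser k P) → 2 ≤ k → ¬ Branching (Recogniser.dfa R) →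
                           ¬ IsAsymptoticAdditiveBasis P
sparse⇒¬asymptotic-basis {k} {P} R 2≤k ¬branching (j , N , basis) =
  overfull (polynomial<exponential 2≤k (rank start) j N)
  where
  open Recogniser R
  open DFA dfa
  open Reachability dfa
  instance
    _ : NonZero k
    _ = >-nonZero (≤-trans (s≤s z≤n) 2≤k)
  overfull : ¬ ∃ λ m → N + suc (suc ((k * suc m) ^ rank start) ^ j) ≤ k ^ m
  overfull (m , room) = ¬covers-longer-interval N (sumsOf j V) covers
    where
    V = values dfa start m
    few : suc (length (sumsOf j V)) ≤ suc (suc ((k * suc m) ^ rank start) ^ j)
    few = s≤s (≤-trans (≤-reflexive (length-sumsOf j V))
                       (^-monoˡ-≤ j (s≤s (values-polynomial dfa ¬branching m start ([] , refl)))))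
    listed : ∀ x → x < k ^ m → P x → x ∈ V
    listed x x<k^m Px with digits-of-length k m x<k^m
    ... | w , refl , refl = ∈-values dfa w start (from (correct w) Px)
    covers : ∀ n → N ≤ n → n < N + suc (length (sumsOf j V)) → n ∈ sumsOf j V
    covers n N≤n n< with basis n N≤n
    ... | xs , ∣xs∣≤j , Pxs , refl = ∈-sumsOf j xs ∣xs∣≤j
      (All-below-sum listed xs (≤-trans n< (≤-trans (+-monoʳ-≤ N few) room)) Pxs)

-- The non-sparse case

-- The numbers Σ_{i<m} cᵢ Kⁱ + Y Kᵐ with every cᵢ ∈ {a, a + e}.
Cantor : (K a e Y : ℕ) → ℕ → Pred ℕ 0ℓ
Cantor K a e Y zero    n = n ≡ Y
Cantor K a e Y (suc m) n = ∃ λ f → Cantor K a e Y m f × (n ≡ a + f * K ⊎ n ≡ a + e + f * K)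

-- With J = K − 1 summands, the number of them using the digit a + e at a given
-- position ranges over all base-K digits.
module _ (J a e Y : ℕ) where

  private
    K = suc J

    Cantor-sums-step : ∀ m j {n} r → r ≤ j → Sums j (Cantor K a e Y m) n →
                       Sums j (Cantor K a e Y (suc m)) (n * K + j * a + r * e)
    Cantor-sums-step m zero    _       z≤n       refl = refl
    Cantor-sums-step m (suc j) zero    z≤n       (f , n , Cf , s , refl) =
      _ , _ , (f , Cf , inj₁ refl) , Cantor-sums-step m j zero z≤n s , regroup f n a j e K
      where
      regroup : ∀ f n a j e K → a + f * K + (n * K + j * a + 0 * e) ≡ (f + n) * K + suc j * a + 0 * e
      regroup = solve-∀
    Cantor-sums-step m (suc j) (suc r) (s≤s r≤j) (f , n , Cf , s , refl) =
      _ , _ , (f , Cf , inj₂ refl) , Cantor-sums-step m j r r≤j s , regroup f n a j e K r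
      where
      regroup : ∀ f n a j e K r → a + e + f * K + (n * K + j * a + r * e) ≡ (f + n) * K + suc j * a + suc r * e
      regroup = solve-∀

  -- `J` times the smallest element, the one all of whose free digits are `a`.
  Cantor-sums-start : ℕ → ℕ
  Cantor-sums-start zero    = J * Y
  Cantor-sums-start (suc m) = Cantor-sums-start m * K + J * a

  -- Since `J = K - 1`, the geometric sum `J a (1 + K + ...)` telescopes to `a (K ^ m - 1)`; adding
  -- `a` avoids the subtraction. Hence the start is O(`K ^ m`).
  Cantor-sums-start-+ : ∀ m → Cantor-sums-start m + a ≡ (J * Y + a) * K ^ m
  Cantor-sums-start-+ zero    = sym (*-identityʳ _)
  Cantor-sums-start-+ (suc m) = begin
    Cantor-sums-start m * K + J * a + a  ≡⟨ regroup (Cantor-sums-start m) J a ⟩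
    (Cantor-sums-start m + a) * K        ≡⟨ cong (_* K) (Cantor-sums-start-+ m) ⟩
    (J * Y + a) * K ^ m * K              ≡⟨ regroup′ (J * Y + a) (K ^ m) K ⟩
    (J * Y + a) * (K * K ^ m)            ∎
    where
    open ≡-Reasoning
    regroup : ∀ A J a → A * suc J + J * a + a ≡ (A + a) * suc J
    regroup = solve-∀
    regroup′ : ∀ x p K → x * p * K ≡ x * (K * p)
    regroup′ = solve-∀

  Cantor-sums : ∀ m t → t < K ^ m → Sums J (Cantor K a e Y m) (Cantor-sums-start m + t * e)
  Cantor-sums zero    zero (s≤s z≤n) = subst (Sums J (_≡ Y)) (sym (+-identityʳ _)) (Sums-replicate J refl)
  Cantor-sums (suc m) t    t<        =
    subst (Sums J (Cantor K a e Y (suc m))) total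
      (Cantor-sums-step m J (t % K) (s≤s⁻¹ (m%n<n t K))
        (Cantor-sums m (t / K) (m<n*o⇒m/o<n (subst (t <_) (*-comm K (K ^ m)) t<))))
    where
    A = Cantor-sums-start m
    regroup : ∀ A q e K J a r → (A + q * e) * K + J * a + r * e ≡ A * K + J * a + (r + q * K) * e
    regroup = solve-∀
    total : (A + t / K * e) * K + J * a + t % K * e ≡ Cantor-sums-start (suc m) + t * e
    total = trans (regroup A (t / K) e K J a (t % K))
                  (cong (λ □ → A * K + J * a + □ * e) (sym (m≡m%n+[m/n]*n t K)))

sum-progressions⇒multiples :
  ∀ {S} J d {K} C → 2 ≤ K → 1 ≤ C → 1 ≤ d →
  (∀ m → ∃ λ B → B ≤ C * K ^ m × (∀ t → t ≤ K ^ m → Sums J S (B + d * t))) →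
  ∃₂ λ J′ N → ∀ n → N ≤ n → SumOfAtMost J′ S (d * n)
sum-progressions⇒multiples {S} J d {K} C 2≤K 1≤C 1≤d progression = d * (C + C * C * K) * J , C * C , multiples
  where
  multiples : ∀ n → C * C ≤ n → SumOfAtMost (d * (C + C * C * K) * J) S (d * n)
  multiples n CC≤n =
    let j , j≤ , s = progressions⇒multiples d C 2≤K 1≤C 1≤d progression n CC≤n
    in SumOfAtMost-mono (*-monoˡ-≤ J j≤) (Sums⇒SumOfAtMost (j * J) (Sums-concat j s))

Cantor⊆⇒multiples : ∀ {S} K a e Y X β → 2 ≤ K → 1 ≤ e → 1 ≤ β →
  (∀ m {f} → Cantor K a e Y m f → S (X + β * f)) →
  ∃₂ λ J N → ∀ n → N ≤ n → SumOfAtMost J S (β * e * n)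
Cantor⊆⇒multiples {S} (suc J) a e Y X β 2≤K 1≤e 1≤β into =
  sum-progressions⇒multiples J (β * e) C 2≤K (s≤s z≤n) (*-mono-≤ 1≤β 1≤e) progression
  where
  K = suc J
  -- The factor `K` pays for working one level higher below; the successor makes `C` positive.
  C = suc ((J * X + β * (J * Y + a)) * K)
  A = Cantor-sums-start J a e Y
  progression : ∀ m → ∃ λ B → B ≤ C * K ^ m × (∀ t → t ≤ K ^ m → Sums J S (B + β * e * t))
  -- Level `m + 1`, because `t = K ^ m` is included here and `Cantor-sums` at level `m` stops just
  -- short of it.
  progression m = J * X + β * A (suc m) , bound , λ t t≤ →
    subst (Sums J S) (regroup (J * X) β (A (suc m)) t e)
      (Sums-affine X β (into (suc m)) J (Cantor-sums J a e Y (suc m) t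
        (≤-<-trans t≤ (subst (K ^ m <_) (*-comm (K ^ m) K) (m<m*n (K ^ m) K {{m^n≢0 K m}} 2≤K)))))
    where
    regroup : ∀ x β A t e → x + β * (A + t * e) ≡ x + β * A + β * e * t
    regroup = solve-∀
    regroup′ : ∀ x β y K p → x * (K * p) + β * (y * (K * p)) ≡ (x + β * y) * K * p
    regroup′ = solve-∀
    bound : J * X + β * A (suc m) ≤ C * K ^ m
    bound = begin
      J * X + β * A (suc m)                                      ≤⟨ +-mono-≤ (m≤m*n (J * X) (K ^ suc m) {{m^n≢0 K (suc m)}})
                                                                           (*-monoʳ-≤ β (m≤m+n (A (suc m)) a)) ⟩
      J * X * K ^ suc m + β * (A (suc m) + a)                    ≡⟨ cong (λ □ → J * X * K ^ suc m + β * □)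
                                                                         (Cantor-sums-start-+ J a e Y (suc m)) ⟩
      J * X * K ^ suc m + β * ((J * Y + a) * K ^ suc m)          ≡⟨ regroup′ (J * X) β (J * Y + a) K (K ^ m) ⟩
      (J * X + β * (J * Y + a)) * K * K ^ m                      ≤⟨ *-monoˡ-≤ (K ^ m) (n≤1+n ((J * X + β * (J * Y + a)) * K)) ⟩
      C * K ^ m                                                  ∎
      where open ≤-Reasoning

record EqualLengthLoops {k} (M : DFA k) : Set where
  open DFA M
  open Reachability M
  field
    x y u v : List (Fin k)
    u-loop  : start · x · u ≡ start · x
    v-loop  : start · x · v ≡ start · x
    accept  : start · x · y ∈ₛ accepting
    ∣u∣≡∣v∣ : length u ≡ length v
    1≤∣u∣   : 1 ≤ length u
    u<v     : fromDigits u < fromDigits v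

-- The two loops may differ in length; their concatenations in both orders do not. These begin with
-- the different digits `a` and `b`, least significant first, so their values differ.
branching⇒loops : ∀ {k} (M : DFA k) → Branching M → EqualLengthLoops M
branching⇒loops {k} M (q , (x , refl) , (_ , (y , refl) , accept) , a , b , a≢b , (u′ , u-loop) , (v′ , v-loop)) =
  by-order (<-cmp (fromDigits (u ++ v)) (fromDigits (v ++ u)))
  where
  open DFA M
  open Reachability M
  u v : List (Fin k)
  u = a ∷ u′
  v = b ∷ v′
  uv-loop : q · (u ++ v) ≡ q
  uv-loop = trans (foldl-++ step q u v) (trans (cong (_· v) u-loop) v-loop)
  vu-loop : q · (v ++ u) ≡ q
  vu-loop = trans (foldl-++ step q v u) (trans (cong (_· u) v-loop) u-loop)
  same-length : length (u ++ v) ≡ length (v ++ u)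
  same-length = trans (length-++ u) (trans (+-comm (length u) (length v)) (sym (length-++ v)))
  by-order : Tri (fromDigits (u ++ v) < fromDigits (v ++ u))
                 (fromDigits (u ++ v) ≡ fromDigits (v ++ u))
                 (fromDigits (v ++ u) < fromDigits (u ++ v)) → EqualLengthLoops M
  by-order (tri< lt _ _) = record
    { x = x ; y = y ; u = u ++ v ; v = v ++ u ; u-loop = uv-loop ; v-loop = vu-loop ; accept = accept
    ; ∣u∣≡∣v∣ = same-length ; 1≤∣u∣ = s≤s z≤n ; u<v = lt }
  by-order (tri> _ _ gt) = record
    { x = x ; y = y ; u = v ++ u ; v = u ++ v ; u-loop = vu-loop ; v-loop = uv-loop ; accept = accept
    ; ∣u∣≡∣v∣ = sym same-length ; 1≤∣u∣ = s≤s z≤n ; u<v = gt }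
  by-order (tri≈ _ eq _) = contradiction
    (toℕ-injective (proj₁ (digit-unique (fromDigits (u′ ++ v)) (fromDigits (v′ ++ u)) (toℕ<n a) (toℕ<n b) eq))) a≢b

-- Each block `u` or `v` is one digit in base `k ^ length u`, of value `a` or `a + e`; `y` supplies
-- the fixed top part, and the prefix `x` becomes an affine map.
loops⇒multiples : ∀ {k P} (R : Recogniser k P) → 2 ≤ k → EqualLengthLoops (Recogniser.dfa R) →
  ∃ λ d → NonZero d × ∃₂ λ J N → ∀ n → N ≤ n → SumOfAtMost J P (d * n)
loops⇒multiples {k} {P} R 2≤k loops = β * e , >-nonZero (*-mono-≤ 1≤β 1≤e) ,
  Cantor⊆⇒multiples (k ^ length u) (fromDigits u) e (fromDigits y) (fromDigits x) β
    (≤-trans 2≤k (≤-trans (≤-reflexive (sym (*-identityʳ k))) (^-monoʳ-≤ k 1≤∣u∣))) 1≤e 1≤β into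
  where
  open Recogniser R
  open DFA dfa
  open Reachability dfa
  open EqualLengthLoops loops
  instance
    _ : NonZero k
    _ = >-nonZero (≤-trans (s≤s z≤n) 2≤k)
  β = k ^ length x
  e = fromDigits v ∸ fromDigits u
  1≤e : 1 ≤ e
  1≤e = m<n⇒0<n∸m u<v
  1≤β : 1 ≤ β
  1≤β = m^n>0 k (length x)
  word : ∀ m {f} → Cantor (k ^ length u) (fromDigits u) e (fromDigits y) m f →
         ∃ λ w → fromDigits w ≡ f × start · x · w ∈ₛ accepting
  word zero    refl = y , refl , accept
  word (suc m) (f , Cf , n≡) with word m Cf | n≡
  ... | w , refl , w∈ | inj₁ refl = u ++ w , fromDigits-++ u w ,
    subst (_∈ₛ accepting) (sym (trans (foldl-++ step _ u w) (cong (_· w) u-loop))) w∈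
  ... | w , refl , w∈ | inj₂ refl = v ++ w ,
    trans (fromDigits-++ v w) (cong₂ (λ □ ■ → □ + fromDigits w * k ^ ■) (sym (m+[n∸m]≡n (<⇒≤ u<v))) (sym ∣u∣≡∣v∣)) ,
    subst (_∈ₛ accepting) (sym (trans (foldl-++ step _ v w) (cong (_· w) v-loop))) w∈
  into : ∀ m {f} → Cantor (k ^ length u) (fromDigits u) e (fromDigits y) m f → P (fromDigits x + β * f)
  into m Cf with word m Cf
  ... | w , refl , w∈ = subst P (trans (fromDigits-++ x w) (cong (fromDigits x +_) (*-comm (fromDigits w) β)))
    (to (correct (x ++ w)) (subst (_∈ₛ accepting) (sym (foldl-++ step start x w)) w∈))

-- Deciding the orders

asymptotic-order-bound : ∀ {k P} → Recogniser k P → 2 ≤ k →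
  ∃ λ B → IsAsymptoticAdditiveBasis P → IsAsymptoticAdditiveBasisOfOrder P B
asymptotic-order-bound R 2≤k with branching? (Recogniser.dfa R)
-- 0 is a placeholder, as the premise is refuted.
... | no ¬branching = 0 , λ basis → contradiction basis (sparse⇒¬asymptotic-basis R 2≤k ¬branching)
... | yes branching with loops⇒multiples R 2≤k (branching⇒loops _ branching)
...   | d , d≢0 , J , N , multiples = d * d + J , multiples⇒order d {{d≢0}} J N multiples

-- A sum equal to 1 has 1 among its terms, so a basis contains 1. Numbers up to `N` are then sums of
-- copies of 1, and larger ones need at most `B` summands.
order-bound : ∀ {k P} → Recogniser k P → 2 ≤ k → ∃ λ B → IsAdditiveBasis P → IsAdditiveBasisOfOrder P B
order-bound {k} {P} R 2≤k with asymptotic-order-bound R 2≤k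
... | B , bound with cofinite? (Recogniser-SumOfAtMost {{>-nonZero (≤-trans (s≤s z≤n) 2≤k)}} R B) 2≤k
...   | no ¬asymptotic = 0 , λ (j , basis) → contradiction (bound (j , 0 , λ n _ → basis n)) ¬asymptotic
...   | yes (N , large) = N * 1 + B , λ (j , basis) →
  let xs , _ , Pxs , eq = basis 1 in covered (some-1 xs Pxs eq)
  where
  some-1 : ∀ xs → All P xs → sum xs ≡ 1 → P 1
  some-1 (zero     ∷ xs) (_ ∷ Pxs) eq = some-1 xs Pxs eq
  some-1 (suc zero ∷ xs) (P1 ∷ _)  _  = P1
  covered : P 1 → ∀ n → SumOfAtMost (N * 1 + B) P n
  covered P1 n with ≤-total N n
  ... | inj₁ N≤n = SumOfAtMost-mono (m≤n+m B (N * 1)) (large n N≤n)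
  ... | inj₂ n≤N = SumOfAtMost-mono (≤-trans (*-monoˡ-≤ 1 n≤N) (m≤m+n (N * 1) B))
    (subst (SumOfAtMost (n * 1) P) (*-identityʳ n) (SumOfAtMost-* n (1 ∷ [] , ≤-refl , P1 ∷ [] , refl)))

-- Passing from the automaton to the set it recognises

SumOfAtMost-cong : ∀ {S T} → (∀ n → S n ⇔ T n) → ∀ j n → SumOfAtMost j S n ⇔ SumOfAtMost j T n
SumOfAtMost-cong S⇔T j n = mk⇔
  (λ (xs , ≤j , Sxs , eq) → xs , ≤j , All.map (to (S⇔T _)) Sxs , eq)
  (λ (xs , ≤j , Txs , eq) → xs , ≤j , All.map (from (S⇔T _)) Txs , eq)

DecidesLeast : Pred ℕ 0ℓ → Pred (Maybe ℕ) 0ℓ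
DecidesLeast P r = Reflects (∃ P) (is-just r) × (∀ j → r ≡ just j → IsLeast P j)

DecidesLeast-cong : ∀ {P Q : Pred ℕ 0ℓ} → (∀ j → P j ⇔ Q j) → ∀ {r} → DecidesLeast P r → DecidesLeast Q r
DecidesLeast-cong {P} {Q} P⇔Q (reflects , least) = transport reflects , λ j eq →
  let Pj , j≤ = least j eq in to (P⇔Q j) Pj , λ i Qi → j≤ i (from (P⇔Q i) Qi)
  where
  transport : ∀ {b} → Reflects (∃ P) b → Reflects (∃ Q) b
  transport (ofʸ (j , Pj)) = ofʸ (j , to (P⇔Q j) Pj)
  transport (ofⁿ none)     = ofⁿ λ (j , Qj) → none (j , from (P⇔Q j) Qj)

-- Failure at `B` refutes every order, by contraposition of the bound; success leaves a finite
-- search.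
least-if-bounded : ∀ {P : Pred ℕ 0ℓ} → Decidable P → ∀ B → (∃ P → P B) → ∃ (DecidesLeast P)
least-if-bounded P? B bounded with P? B
... | no ¬PB = nothing , ofⁿ (¬PB ∘ bounded) , λ _ ()
... | yes PB with IsLeast-exists P? B PB
...   | l , least = just l , ofʸ (B , PB) , λ { _ refl → least }

module _ {k} (2≤k : 2 ≤ k) (M : DFA k) where

  private
    instance
      _ : NonZero k
      _ = >-nonZero (≤-trans (s≤s z≤n) 2≤k)

    R : Recogniser k (Members M)
    R = Recogniser-Members M

  abstract
    least-asymptotic-order : ∃ (DecidesLeast (IsAsymptoticAdditiveBasisOfOrder (Members M)))
    least-asymptotic-order =
      let B , bound = asymptotic-order-bound R 2≤k
      in least-if-bounded (λ j → cofinite? (Recogniser-SumOfAtMost R j) 2≤k) B bound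

    least-order : ∃ (DecidesLeast (IsAdditiveBasisOfOrder (Members M)))
    least-order =
      let B , bound = order-bound R 2≤k
      in least-if-bounded (λ j → universal? (Recogniser-SumOfAtMost R j) 2≤k) B bound

  module _ {S} (recognises : M Recognises S) where

    private
      sums : ∀ j n → SumOfAtMost j (Members M) n ⇔ SumOfAtMost j S n
      sums = SumOfAtMost-cong λ n →
        let S⇔Members = Recognises⇒Members M 2≤k recognises n in mk⇔ (from S⇔Members) (to S⇔Members)

    asymptotic-order-transfer :
      ∀ j → IsAsymptoticAdditiveBasisOfOrder (Members M) j ⇔ IsAsymptoticAdditiveBasisOfOrder S j
    asymptotic-order-transfer j = mk⇔
      (λ (N , large) → N , λ n N≤n → to (sums j n) (large n N≤n))
      (λ (N , large) → N , λ n N≤n → from (sums j n) (large n N≤n))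

    order-transfer : ∀ j → IsAdditiveBasisOfOrder (Members M) j ⇔ IsAdditiveBasisOfOrder S j
    order-transfer j = mk⇔ (λ all n → to (sums j n) (all n)) (λ all n → from (sums j n) (all n))

mainTheorem5 : ∀ (k : ℕ) → 2 ≤ k →
  (Σ[ alg ∈ (DFA k → Maybe ℕ) ]
    (∀ (M : DFA k) (S : Pred ℕ 0ℓ) → M Recognises S →
      Reflects (IsAsymptoticAdditiveBasis S) (is-just (alg M)) ×
      (∀ j → alg M ≡ just j → IsLeast (IsAsymptoticAdditiveBasisOfOrder S) j)))
  ×
  (Σ[ alg ∈ (DFA k → Maybe ℕ) ]
    (∀ (M : DFA k) (S : Pred ℕ 0ℓ) → M Recognises S →
      Reflects (IsAdditiveBasis S) (is-just (alg M)) ×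
      (∀ j → alg M ≡ just j → IsLeast (IsAdditiveBasisOfOrder S) j)))
mainTheorem5 k 2≤k =
  ( (λ M → proj₁ (least-asymptotic-order 2≤k M))
  , λ M S recognises → DecidesLeast-cong (asymptotic-order-transfer 2≤k M recognises)
                                         (proj₂ (least-asymptotic-order 2≤k M)) ) ,
  ( (λ M → proj₁ (least-order 2≤k M))
  , λ M S recognises → DecidesLeast-cong (order-transfer 2≤k M recognises) (proj₂ (least-order 2≤k M)) )
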